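{- For any integers $r,k\geq 1$, \[ \zeta(\underbrace{1, \ldots , 1}_{r-1}, k+1) =\sum^{\min(r,k)}_{j=1}(-1)^{j-1}\sum_{\substack{\mathrm{wt}(\mathbf{a})=k,\,\mathrm{wt}(\mathbf{b})=r\\ \mathrm{dep}(\mathbf{a})=\mathrm{dep}(\mathbf{b})=j}} \zeta(\mathbf{a}+\mathbf{b}), \] where the inner sum runs over all pairs of indices $\mathbf{a}=(a_1,\ldots,a_j)$, $\mathbf{b}=(b_1,\ldots,b_j)$ of positive integers with $a_1+\cdots+a_j=k$ and $b_1+\cdots+b_j=r$, and $\zeta(\mathbf{a}+\mathbf{b})$ denotes $\zeta(a_1+b_1,\ldots,a_j+b_j)$.
   Context: For an index $\mathbf{k}=(k_1,\ldots,k_r)$ of positive integers with $k_r>1$, the multiple zeta value is $\zeta(k_1,\ldots,k_r)=\sum_{0<m_1<\cdots<m_r} m_1^{ -k_1}\cdots m_r^{ -k_r}$. The weight of an index is $\mathrm{wt}(\mathbf{k})=k_1+\cdots+k_r$ and its depth is $\mathrm{dep}(\mathbf{k})=r$. -}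

module Defs where

open import Data.Nat as ℕ using (ℕ; zero; suc; _∸_; _⊓_)
open import Data.Integer using (+_)
open import Data.List using (List; []; _∷_; map; concat; upTo; foldr; zipWith; reverse; replicate; _++_; [_])
open import Data.Rational using (ℚ; 0ℚ; 1ℚ; _/_; _+_; _*_; -_)

sumℚ : List ℚ → ℚ
sumℚ = foldr _+_ 0ℚ

powℚ : ℚ → ℕ → ℚ
powℚ q zero = 1ℚ
powℚ q (suc k) = q * powℚ q k

-- (-1)^(j-1) for j ≥ 1 ; signℚ j = (-1)^(j-1)  (value at 0 irrelevant)
signℚ : ℕ → ℚ
signℚ zero = - 1ℚ
signℚ (suc zero) = 1ℚ
signℚ (suc (suc j)) = signℚ j

-- Truncated MZV on a REVERSED index (last entry first):
-- Zrev N (k_r ∷ k_{r-1} ∷ … ∷ k_1 ∷ [])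
--   = Σ_{0 < m_1 < … < m_r ≤ N} m_1^{-k_1} ⋯ m_r^{-k_r}
Zrev : ℕ → List ℕ → ℚ
Zrev N [] = 1ℚ
Zrev zero (k ∷ ks) = 0ℚ
Zrev (suc N) (k ∷ ks) = Zrev N (k ∷ ks) + powℚ (+ 1 / suc N) k * Zrev N ks

ζ≤ : ℕ → List ℕ → ℚ
ζ≤ N ks = Zrev N (reverse ks)

comps : ℕ → ℕ → List (List ℕ)
comps zero zero = [] ∷ []
comps (suc n) zero = []
comps n (suc j) =
  concat (map (λ a → map (suc a ∷_) (comps (n ∸ suc a) j)) (upTo n))

lhsIndex : ℕ → ℕ → List ℕ
lhsIndex r k = replicate (r ∸ 1) 1 ++ [ suc k ]

rhs≤ : ℕ → ℕ → ℕ → ℚ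
rhs≤ N r k =
  sumℚ (map (λ i → signℚ (suc i) *
                   sumℚ (concat (map (λ a → map (λ b → ζ≤ N (zipWith ℕ._+_ a b))
                                                (comps r (suc i)))
                                     (comps k (suc i)))))
            (upTo (r ⊓ k)))

{-# OPTIONS --safe #-}
-- Write P_N(x,y) = Π_{m≤N} m(m-x-y) / ((m-x)(m-y)).  Since
-- 1 - Σ_{a,b≥1} (x/m)^a (y/m)^b = m(m-x-y) / ((m-x)(m-y)), the truncated right-hand side is
-- minus the coefficient of x^k y^r in P_N.  The Pfaff–Saalschütz summation gives
--   P_N = Σ_{n=0}^{N} -x/(n-x) · (y)_n/n! · Π_{N-n<m≤N} (1-y/m)^{-1}     (with -x/(n-x) = 1 at n = 0),
-- and the truncated left-hand side is minus the coefficient of the same sum without the last product.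
-- The difference of the two is therefore a sum of nonnegative terms, of size O((log N)^r / N).
module Submission where

open import Defs
open import Data.Nat as ℕ using (ℕ; zero; suc)
import Data.Nat.Properties as ℕₚ
open import Data.Integer as ℤ using (+_; -[1+_])
import Data.Integer.Properties as ℤₚ
open import Data.List using (List; []; _∷_; map; concat; upTo; applyUpTo; zipWith; reverse; replicate; _++_; [_]; length)
import Data.List.Properties as Listₚ
open import Data.Product using (∃-syntax; _×_; _,_; proj₁; proj₂)
open import Data.Rational hiding (truncate)
open import Data.Rational.Properties
open import Data.Rational.Unnormalised as ℚᵘ using (mkℚᵘ)
import Data.Rational.Unnormalised.Properties as ℚᵘₚ
open import Function using (_∘_; id)
open import Level using (0ℓ)
open import Relation.Binary.PropositionalEquality hiding ([_])
open import Relation.Nullary.Decidable using (dec⇒maybe)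
open import Tactic.RingSolver using (solve-∀)
open import Tactic.RingSolver.Core.AlmostCommutativeRing using (AlmostCommutativeRing; fromCommutativeRing)
open ≤-Reasoning

-- The two truncations generally differ at finite N, so no finite identity between them can be the
-- goal. The transformed sum is useful because its n-th term pairs with the part of the left-hand
-- side whose largest summation variable is n. The summation formula is not quoted: its sum is shown
-- to obey P_{N+1} (1 - x/(N+1)) (1 - y/(N+1)) = P_N (1 - (x+y)/(N+1)), the recurrence that defines
-- the product. The two variables are treated unequally. The weight c = -x/(n-x) satisfies n c = x
-- (c - 1), so multiplication by n lowers the degree in x, and each coefficient in x is a plain
-- weight in n; powers of y are kept as coefficient sequences. Neighbouring summands are related
-- only up to the factor 1 - y/(N+1), so the recurrences are proved after multiplication by it and
-- it is cancelled afterwards. Logarithms never appear: harmonic numbers replace them, and induction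
-- on the exponent bounds their powers by εN + C for every ε > 0.

ring : AlmostCommutativeRing 0ℓ 0ℓ
ring = fromCommutativeRing +-*-commutativeRing (λ x → dec⇒maybe (0ℚ ≟ x))

-- Rational arithmetic: natural numbers and their reciprocals.

interchange : ∀ a b c d → a + b + (c + d) ≡ a + c + (b + d)
interchange = solve-∀ ring

-- Recursive, so that `num (suc n)` unfolds to `1ℚ + num n` in ring identities; the link to the
-- fraction n/1 is needed only for `num*inv` and `archimedean`.
num : ℕ → ℚ
num zero = 0ℚ
num (suc n) = 1ℚ + num n

-- The default 0 at 0 lets sums of 1/n start at n = 0, as in `conv-inv`.
inv : ℕ → ℚ
inv zero = 0ℚ
inv (suc n) = + 1 / suc n

fromℚᵘ-homo-+ : ∀ p q → fromℚᵘ p + fromℚᵘ q ≡ fromℚᵘ (p ℚᵘ.+ q)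
fromℚᵘ-homo-+ p q = toℚᵘ-injective (ℚᵘₚ.≃-trans (toℚᵘ-homo-+ (fromℚᵘ p) (fromℚᵘ q))
  (ℚᵘₚ.≃-trans (ℚᵘₚ.+-cong (toℚᵘ-fromℚᵘ p) (toℚᵘ-fromℚᵘ q)) (ℚᵘₚ.≃-sym (toℚᵘ-fromℚᵘ (p ℚᵘ.+ q)))))

fromℚᵘ-homo-* : ∀ p q → fromℚᵘ p * fromℚᵘ q ≡ fromℚᵘ (p ℚᵘ.* q)
fromℚᵘ-homo-* p q = toℚᵘ-injective (ℚᵘₚ.≃-trans (toℚᵘ-homo-* (fromℚᵘ p) (fromℚᵘ q))
  (ℚᵘₚ.≃-trans (ℚᵘₚ.*-cong (toℚᵘ-fromℚᵘ p) (toℚᵘ-fromℚᵘ q)) (ℚᵘₚ.≃-sym (toℚᵘ-fromℚᵘ (p ℚᵘ.* q)))))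

num≡/1 : ∀ n → num n ≡ fromℚᵘ (mkℚᵘ (+ n) 0)
num≡/1 zero = refl
num≡/1 (suc n) = begin-equality
  1ℚ + num n                                    ≡⟨ cong (_+_ 1ℚ) (num≡/1 n) ⟩
  fromℚᵘ (mkℚᵘ (+ 1) 0) + fromℚᵘ (mkℚᵘ (+ n) 0) ≡⟨ fromℚᵘ-homo-+ (mkℚᵘ (+ 1) 0) (mkℚᵘ (+ n) 0) ⟩
  fromℚᵘ (mkℚᵘ (+ 1) 0 ℚᵘ.+ mkℚᵘ (+ n) 0)       ≡⟨ cong (λ m → fromℚᵘ (mkℚᵘ m 0)) (cong₂ ℤ._+_ (ℤₚ.*-identityʳ (+ 1)) (ℤₚ.*-identityʳ (+ n))) ⟩
  fromℚᵘ (mkℚᵘ (+ suc n) 0)                     ∎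

num*inv : ∀ n → num (suc n) * inv (suc n) ≡ 1ℚ
num*inv n = begin-equality
  num (suc n) * inv (suc n)                       ≡⟨ cong (_* inv (suc n)) (num≡/1 (suc n)) ⟩
  fromℚᵘ (mkℚᵘ (+ suc n) 0) * fromℚᵘ (mkℚᵘ (+ 1) n) ≡⟨ fromℚᵘ-homo-* (mkℚᵘ (+ suc n) 0) (mkℚᵘ (+ 1) n) ⟩
  fromℚᵘ (mkℚᵘ (+ suc n) 0 ℚᵘ.* mkℚᵘ (+ 1) n)     ≡⟨ fromℚᵘ-cong {mkℚᵘ (+ suc n) 0 ℚᵘ.* mkℚᵘ (+ 1) n} {mkℚᵘ (+ 1) 0} (ℚᵘ.*≡* (trans (ℤₚ.*-identityʳ _) (trans (ℤₚ.*-identityʳ (+ suc n)) (sym (trans (ℤₚ.*-identityˡ _) (ℤₚ.*-identityˡ (+ suc n))))))) ⟩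
  1ℚ                                              ∎

0≤inv : ∀ n → 0ℚ ≤ inv n
0≤inv zero = ≤-refl
0≤inv (suc n) = nonNegative⁻¹ (inv (suc n)) {{normalize-nonNeg 1 (suc n)}}

0≤+ : ∀ {p q} → 0ℚ ≤ p → 0ℚ ≤ q → 0ℚ ≤ p + q
0≤+ = +-mono-≤

*-mono-≤ : ∀ {a b c d} → 0ℚ ≤ b → 0ℚ ≤ c → a ≤ b → c ≤ d → a * c ≤ b * d
*-mono-≤ {a} {b} {c} {d} 0≤b 0≤c a≤b c≤d =
  ≤-trans (*-monoʳ-≤-nonNeg c {{nonNegative 0≤c}} a≤b) (*-monoˡ-≤-nonNeg b {{nonNegative 0≤b}} c≤d)

0≤* : ∀ {p q} → 0ℚ ≤ p → 0ℚ ≤ q → 0ℚ ≤ p * q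
0≤* {p} {q} 0≤p 0≤q = ≤-trans (≤-reflexive (sym (*-zeroˡ 0ℚ))) (*-mono-≤ 0≤p ≤-refl 0≤p 0≤q)

-- Convolution sums.

-- Σ_{a + b + 1 = n} f a b; the shift by one makes the sum empty at n = 0, as comps requires.
conv : (ℕ → ℕ → ℚ) → ℕ → ℚ
conv f zero = 0ℚ
conv f (suc n) = f 0 n + conv (λ a → f (suc a)) n

conv-cong : ∀ {f g} n → (∀ a m → suc (a ℕ.+ m) ≡ n → f a m ≡ g a m) → conv f n ≡ conv g n
conv-cong zero _ = refl
conv-cong (suc n) h = cong₂ _+_ (h 0 n refl) (conv-cong n (λ a m e → h (suc a) m (cong suc e)))

conv-ext : ∀ {f g} n → (∀ a m → f a m ≡ g a m) → conv f n ≡ conv g n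
conv-ext n h = conv-cong n (λ a m _ → h a m)

conv-mono-≤ : ∀ {f g} n → (∀ a m → suc (a ℕ.+ m) ≡ n → f a m ≤ g a m) → conv f n ≤ conv g n
conv-mono-≤ zero _ = ≤-refl
conv-mono-≤ (suc n) h = +-mono-≤ (h 0 n refl) (conv-mono-≤ n (λ a m e → h (suc a) m (cong suc e)))

conv-0 : ∀ n → conv (λ _ _ → 0ℚ) n ≡ 0ℚ
conv-0 zero = refl
conv-0 (suc n) = trans (+-identityˡ _) (conv-0 n)

conv-+ : ∀ f g n → conv (λ a m → f a m + g a m) n ≡ conv f n + conv g n
conv-+ f g zero = refl
conv-+ f g (suc n) = trans (cong (_+_ (f 0 n + g 0 n)) (conv-+ (λ a → f (suc a)) (λ a → g (suc a)) n))
  (interchange (f 0 n) (g 0 n) _ _)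

conv-* : ∀ c f n → conv (λ a m → c * f a m) n ≡ c * conv f n
conv-* c f zero = sym (*-zeroʳ c)
conv-* c f (suc n) = trans (cong (_+_ (c * f 0 n)) (conv-* c (λ a → f (suc a)) n)) (sym (*-distribˡ-+ c (f 0 n) _))

conv-last : ∀ f n → conv f (suc n) ≡ f n 0 + conv (λ a m → f a (suc m)) n
conv-last f zero = refl
conv-last f (suc n) = trans (cong (_+_ (f 0 (suc n))) (conv-last (λ a → f (suc a)) n)) (swap (f 0 (suc n)) (f (suc n) 0) _)
  where
  swap : ∀ a b c → a + (b + c) ≡ b + (a + c)
  swap = solve-∀ ring

-- The triangle of pairs (a, b) is cut into its corner `x`, its two edges `y` and `z`, and an
-- interior that is a smaller triangle of the same kind.
conv-swap : ∀ (G : ℕ → ℕ → ℕ → ℚ) n →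
  conv (λ a → conv (λ b → G a b)) n ≡ conv (λ b → conv (λ a → G a b)) n
conv-swap G zero = refl
conv-swap G (suc zero) = refl
conv-swap G (suc (suc n)) = begin-equality
  (x + y) + conv (λ a → conv (G (suc a))) (suc n)
    ≡⟨ cong (_+_ (x + y)) (conv-swap (λ a → G (suc a)) (suc n)) ⟩
  (x + y) + (z + conv (λ b → conv (λ a → G (suc a) (suc b))) n)
    ≡⟨ cong (λ t → (x + y) + (z + t)) (sym (conv-swap (λ a b → G (suc a) (suc b)) n)) ⟩
  (x + y) + (z + conv (λ a → conv (λ b → G (suc a) (suc b))) n)
    ≡⟨ interchange x y z _ ⟩
  (x + z) + (y + conv (λ a → conv (λ b → G (suc a) (suc b))) n)
    ≡⟨ cong (_+_ (x + z)) (conv-swap (λ a b → G a (suc b)) (suc n)) ⟩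
  (x + z) + conv (λ b → conv (λ a → G a (suc b))) (suc n) ∎
  where
  x = G 0 0 n
  y = conv (λ b → G 0 (suc b)) n
  z = conv (λ a → G (suc a) 0) n

-- Power series in y: linear factors and their inverses.

-- coefficients of a power series in y
Series : Set
Series = ℕ → ℚ

shift : Series → Series
shift f zero = 0ℚ
shift f (suc s) = f s

mulLin : ℚ → ℚ → Series → Series
mulLin c d f s = c * f s + d * shift f s

-- multiplication by 1/(1 - q y)
geo : ℚ → Series → Series
geo q f zero = f 0
geo q f (suc s) = f (suc s) + q * geo q f s

geo-ext : ∀ q {f g} → (∀ s → f s ≡ g s) → ∀ s → geo q f s ≡ geo q g s
geo-ext q h zero = h 0
geo-ext q h (suc s) = cong₂ (λ x y → x + q * y) (h (suc s)) (geo-ext q h s)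

geo-unfold : ∀ q f s → geo q f s ≡ f s + q * shift (geo q f) s
geo-unfold q f zero = x≡x+q*0 (f 0) q
  where
  x≡x+q*0 : ∀ x q → x ≡ x + q * 0ℚ
  x≡x+q*0 = solve-∀ ring
geo-unfold q f (suc s) = refl

-- The equation (1 - q y) g = f determines the coefficients of g one after another. Inversion and
-- commutation of `geo` are both read off from this.
geo-unique : ∀ q {f g} → (∀ s → g s ≡ f s + q * shift g s) → ∀ s → g s ≡ geo q f s
geo-unique q {f} {g} h zero = trans (h 0) (sym (geo-unfold q f 0))
geo-unique q {f} {g} h (suc s) = trans (h (suc s)) (cong (λ x → f (suc s) + q * x) (geo-unique q h s))

geo-cancel : ∀ q f s → mulLin 1ℚ (- q) (geo q f) s ≡ f s
geo-cancel q f s = trans (cong (λ x → 1ℚ * x + - q * shift (geo q f) s) (geo-unfold q f s)) (cancel q (f s) _)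
  where
  cancel : ∀ q x y → 1ℚ * (x + q * y) + - q * y ≡ x
  cancel = solve-∀ ring

geo-inverse : ∀ q f s → f s ≡ geo q (mulLin 1ℚ (- q) f) s
geo-inverse q f = geo-unique q (λ s → cancel q (f s) _)
  where
  cancel : ∀ q x y → x ≡ 1ℚ * x + - q * y + q * y
  cancel = solve-∀ ring

shift-mulLin : ∀ c d f s → shift (mulLin c d f) s ≡ mulLin c d (shift f) s
shift-mulLin c d f zero = zeros c d
  where
  zeros : ∀ c d → 0ℚ ≡ c * 0ℚ + d * 0ℚ
  zeros = solve-∀ ring
shift-mulLin c d f (suc s) = refl

geo-mulLin : ∀ q c d f s → geo q (mulLin c d f) s ≡ mulLin c d (geo q f) s
geo-mulLin q c d f s = sym (geo-unique q (λ s → begin-equality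
  c * g s + d * shift g s
    ≡⟨ cong₂ (λ x y → c * x + d * y) (geo-unfold q f s) (shift-unfold s) ⟩
  c * (f s + q * shift g s) + d * (shift f s + q * shift (shift g) s)
    ≡⟨ regroup c d q (f s) (shift g s) (shift f s) _ ⟩
  (c * f s + d * shift f s) + q * (c * shift g s + d * shift (shift g) s)
    ≡⟨ cong (λ x → mulLin c d f s + q * x) (sym (shift-mulLin c d g s)) ⟩
  mulLin c d f s + q * shift (mulLin c d g) s ∎) s)
  where
  g = geo q f
  shift-unfold : ∀ s → shift g s ≡ shift f s + q * shift (shift g) s
  shift-unfold zero = zeros q
    where
    zeros : ∀ q → 0ℚ ≡ 0ℚ + q * 0ℚ
    zeros = solve-∀ ring
  shift-unfold (suc s) = geo-unfold q f s
  regroup : ∀ c d q x y z t → c * (x + q * y) + d * (z + q * t) ≡ (c * x + d * z) + q * (c * y + d * t)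
  regroup = solve-∀ ring

-- The hypergeometric summand and its neighbours.

-- (y)_n / n!
rising : ℕ → Series
rising zero zero = 1ℚ
rising zero (suc s) = 0ℚ
rising (suc n) = mulLin (inv (suc n) * num n) (inv (suc n)) (rising n)

-- multiplication by Π_{m<i≤m+n} (1 - y/i)^{-1}
geos : ℕ → ℕ → Series → Series
geos zero m f = f
geos (suc n) m f = geo (inv (suc (n ℕ.+ m))) (geos n m f)

geos-mulLin : ∀ n m c d f s → geos n m (mulLin c d f) s ≡ mulLin c d (geos n m f) s
geos-mulLin zero m c d f s = refl
geos-mulLin (suc n) m c d f s =
  trans (geo-ext q (geos-mulLin n m c d f) s) (geo-mulLin q c d (geos n m f) s)
  where q = inv (suc (n ℕ.+ m))

-- Sliding the window m+1, ..., m+n up by one changes only the two end factors: both sides equal f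
-- times the product over m+2, ..., m+n when n ≥ 1.
geos-suc : ∀ n m f s → mulLin 1ℚ (- inv (suc (n ℕ.+ m))) (geos n (suc m) f) s ≡ geos n m (mulLin 1ℚ (- inv (suc m)) f) s
geos-suc zero m f s = refl
geos-suc (suc n) m f s = begin-equality
  mulLin 1ℚ (- inv (suc (suc n ℕ.+ m))) (geo (inv (suc (n ℕ.+ suc m))) g) s
    ≡⟨ cong (λ k → mulLin 1ℚ (- inv (suc k)) (geo (inv (suc (n ℕ.+ suc m))) g) s) (sym (ℕₚ.+-suc n m)) ⟩
  mulLin 1ℚ (- inv (suc (n ℕ.+ suc m))) (geo (inv (suc (n ℕ.+ suc m))) g) s
    ≡⟨ geo-cancel (inv (suc (n ℕ.+ suc m))) g s ⟩
  g s
    ≡⟨ geo-inverse q g s ⟩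
  geo q (mulLin 1ℚ (- q) g) s
    ≡⟨ geo-ext q (geos-suc n m f) s ⟩
  geo q (geos n m (mulLin 1ℚ (- inv (suc m)) f)) s ∎
  where
  g = geos n (suc m) f
  q = inv (suc (n ℕ.+ m))

term : ℕ → ℕ → Series
term n m = geos n m (rising n)

-- This and `term-sucʳ` are the contiguous relations of the summand. Both carry the factor 1 -
-- y/(n+m+1), which depends on n + m alone and so comes out of the sum over n + m = N.
term-sucˡ : ∀ n m s → mulLin 1ℚ (- inv (suc (n ℕ.+ m))) (term (suc n) m) s ≡ mulLin (inv (suc n) * num n) (inv (suc n)) (term n m) s
term-sucˡ n m s = trans (geo-cancel (inv (suc (n ℕ.+ m))) _ s) (geos-mulLin n m (inv (suc n) * num n) (inv (suc n)) (rising n) s)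

term-sucʳ : ∀ n m s → mulLin 1ℚ (- inv (suc (n ℕ.+ m))) (term n (suc m)) s ≡ mulLin 1ℚ (- inv (suc m)) (term n m) s
term-sucʳ n m s = trans (geos-suc n m (rising n) s) (geos-mulLin n m 1ℚ (- inv (suc m)) (rising n) s)

-- Recurrences in N for weighted sums of the summand.

weighted : (ℕ → ℚ) → ℕ → Series
weighted c N s = conv (λ n m → c n * term n m s) (suc N)

shift-conv : ∀ (F : ℕ → ℕ → Series) n s → shift (λ t → conv (λ a b → F a b t) n) s ≡ conv (λ a b → shift (F a b) s) n
shift-conv F n zero = sym (conv-0 n)
shift-conv F n (suc s) = refl

weighted-mulLin : ∀ α β c N s →
  mulLin α β (weighted c N) s ≡ conv (λ n m → c n * mulLin α β (term n m) s) (suc N)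
weighted-mulLin α β c N s = begin-equality
  α * weighted c N s + β * shift (weighted c N) s
    ≡⟨ cong (λ x → α * weighted c N s + β * x)
         (trans (shift-conv (λ n m t → c n * term n m t) (suc N) s)
                (conv-ext (suc N) (λ n m → shift-scale (c n) (term n m) s))) ⟩
  α * weighted c N s + β * conv (λ n m → c n * shift (term n m) s) (suc N)
    ≡⟨ sym (cong₂ _+_ (conv-* α (λ n m → c n * term n m s) (suc N)) (conv-* β (λ n m → c n * shift (term n m) s) (suc N))) ⟩
  conv (λ n m → α * (c n * term n m s)) (suc N) + conv (λ n m → β * (c n * shift (term n m) s)) (suc N)
    ≡⟨ sym (conv-+ (λ n m → α * (c n * term n m s)) (λ n m → β * (c n * shift (term n m) s)) (suc N)) ⟩
  conv (λ n m → α * (c n * term n m s) + β * (c n * shift (term n m) s)) (suc N)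
    ≡⟨ conv-ext (suc N) (λ n m → regroup α β (c n) (term n m s) (shift (term n m) s)) ⟩
  conv (λ n m → c n * mulLin α β (term n m) s) (suc N) ∎
  where
  shift-scale : ∀ k f s → shift (λ t → k * f t) s ≡ k * shift f s
  shift-scale k f zero = sym (*-zeroʳ k)
  shift-scale k f (suc s) = refl
  regroup : ∀ α β c x y → α * (c * x) + β * (c * y) ≡ c * (α * x + β * y)
  regroup = solve-∀ ring

num-+ : ∀ a b → num (a ℕ.+ b) ≡ num a + num b
num-+ zero b = sym (+-identityˡ (num b))
num-+ (suc a) b = trans (cong (_+_ 1ℚ) (num-+ a b)) (sym (+-assoc 1ℚ (num a) (num b)))

inv-cancel : ∀ n x → inv (suc n) * (num (suc n) * x) ≡ x
inv-cancel n x = trans (regroup (inv (suc n)) (num (suc n)) x) (trans (cong (_* x) (num*inv n)) (*-identityˡ x))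
  where
  regroup : ∀ i k x → i * (k * x) ≡ k * i * x
  regroup = solve-∀ ring

-- This is the Pfaff–Saalschütz recurrence in N: multiply by N + 1 = n + m, absorb n into the weight,
-- and lower m with term-sucʳ.
weighted-step : ∀ c e → (∀ n → e n ≡ num n * c n) → ∀ N s →
  mulLin 1ℚ (- inv (suc N)) (weighted c (suc N)) s
    ≡ mulLin 1ℚ (- inv (suc N)) (weighted c N) s
      + inv (suc N) * (mulLin 1ℚ (- inv (suc N)) (weighted e (suc N)) s - weighted e N s)
weighted-step c e e≡ N s = begin-equality
  D (weighted c (suc N)) s
    ≡⟨ sym (inv-cancel N _) ⟩
  q * (k * D (weighted c (suc N)) s)
    ≡⟨ cong (_*_ q) scaled ⟩
  q * (D (weighted e (suc N)) s + (k * D (weighted c N) s + - 1ℚ * weighted e N s))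
    ≡⟨ regroup q k (D (weighted e (suc N)) s) (D (weighted c N) s) (weighted e N s) ⟩
  q * (k * D (weighted c N) s) + q * (D (weighted e (suc N)) s - weighted e N s)
    ≡⟨ cong (_+ q * (D (weighted e (suc N)) s - weighted e N s)) (inv-cancel N (D (weighted c N) s)) ⟩
  D (weighted c N) s + q * (D (weighted e (suc N)) s - weighted e N s) ∎
  where
  q = inv (suc N)
  k = num (suc N)
  D = mulLin 1ℚ (- q)
  regroup : ∀ q k x y z → q * (x + (k * y + - 1ℚ * z)) ≡ q * (k * y) + q * (x - z)
  regroup = solve-∀ ring
  split : ∀ n m → suc (n ℕ.+ m) ≡ suc (suc N) →
    k * (c n * D (term n m) s) ≡ e n * D (term n m) s + num m * (c n * D (term n m) s)
  split n m eq = begin-equality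
    k * (c n * D (term n m) s)
      ≡⟨ cong (_* (c n * D (term n m) s)) (trans (cong num (sym (ℕₚ.suc-injective eq))) (num-+ n m)) ⟩
    (num n + num m) * (c n * D (term n m) s)
      ≡⟨ distrib (num n) (num m) (c n) (D (term n m) s) ⟩
    num n * c n * D (term n m) s + num m * (c n * D (term n m) s)
      ≡⟨ cong (λ x → x * D (term n m) s + num m * (c n * D (term n m) s)) (sym (e≡ n)) ⟩
    e n * D (term n m) s + num m * (c n * D (term n m) s) ∎
    where
    distrib : ∀ a b x y → (a + b) * (x * y) ≡ a * x * y + b * (x * y)
    distrib = solve-∀ ring
  lower : ∀ n m → suc (n ℕ.+ m) ≡ suc N →
    num (suc m) * (c n * D (term n (suc m)) s) ≡ k * (c n * D (term n m) s) + - 1ℚ * (e n * term n m s)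
  lower n m refl = begin-equality
    num (suc m) * (c n * D (term n (suc m)) s)
      ≡⟨ cong (λ x → num (suc m) * (c n * x)) (term-sucʳ n m s) ⟩
    num (suc m) * (c n * (1ℚ * t + - inv (suc m) * t′))
      ≡⟨ expand (num m) (c n) t t′ (inv (suc m)) ⟩
    num (suc m) * (c n * t) - c n * t′ * (num (suc m) * inv (suc m))
      -- Both products are 1, so y/(m+1) can be traded for y/(N+1). What remains is m + 1 - y = (N +
      -- 1 - y) - n.
      ≡⟨ cong (λ x → num (suc m) * (c n * t) - c n * t′ * x) (trans (num*inv m) (sym (num*inv (n ℕ.+ m)))) ⟩
    num (suc m) * (c n * t) - c n * t′ * (k * q)
      ≡⟨ cong (λ x → num (suc m) * (c n * t) - c n * t′ * ((1ℚ + x) * q)) (num-+ n m) ⟩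
    num (suc m) * (c n * t) - c n * t′ * ((1ℚ + (num n + num m)) * q)
      ≡⟨ collect (num n) (num m) (c n) t t′ q ⟩
    (1ℚ + (num n + num m)) * (c n * D (term n m) s) + - 1ℚ * (num n * c n * t)
      ≡⟨ cong₂ (λ x y → (1ℚ + x) * (c n * D (term n m) s) + - 1ℚ * (y * t)) (sym (num-+ n m)) (sym (e≡ n)) ⟩
    k * (c n * D (term n m) s) + - 1ℚ * (e n * t) ∎
    where
    t = term n m s
    t′ = shift (term n m) s
    expand : ∀ b c t t′ i → (1ℚ + b) * (c * (1ℚ * t + - i * t′)) ≡ (1ℚ + b) * (c * t) - c * t′ * ((1ℚ + b) * i)
    expand = solve-∀ ring
    collect : ∀ a b c t t′ q → (1ℚ + b) * (c * t) - c * t′ * ((1ℚ + (a + b)) * q)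
      ≡ (1ℚ + (a + b)) * (c * (1ℚ * t + - q * t′)) + - 1ℚ * (a * c * t)
    collect = solve-∀ ring
  scaled : k * D (weighted c (suc N)) s ≡ D (weighted e (suc N)) s + (k * D (weighted c N) s + - 1ℚ * weighted e N s)
  scaled = begin-equality
    k * D (weighted c (suc N)) s
      ≡⟨ cong (_*_ k) (weighted-mulLin 1ℚ (- q) c (suc N) s) ⟩
    k * conv (λ n m → c n * D (term n m) s) (suc (suc N))
      ≡⟨ sym (conv-* k (λ n m → c n * D (term n m) s) (suc (suc N))) ⟩
    conv (λ n m → k * (c n * D (term n m) s)) (suc (suc N))
      ≡⟨ conv-cong (suc (suc N)) split ⟩
    conv (λ n m → e n * D (term n m) s + num m * (c n * D (term n m) s)) (suc (suc N))
      ≡⟨ conv-+ (λ n m → e n * D (term n m) s) (λ n m → num m * (c n * D (term n m) s)) (suc (suc N)) ⟩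
    conv (λ n m → e n * D (term n m) s) (suc (suc N)) + conv (λ n m → num m * (c n * D (term n m) s)) (suc (suc N))
      ≡⟨ cong₂ _+_ (sym (weighted-mulLin 1ℚ (- q) e (suc N) s)) lowered ⟩
    D (weighted e (suc N)) s + (k * D (weighted c N) s + - 1ℚ * weighted e N s) ∎
    where
    lowered : conv (λ n m → num m * (c n * D (term n m) s)) (suc (suc N)) ≡ k * D (weighted c N) s + - 1ℚ * weighted e N s
    lowered = begin-equality
      conv (λ n m → num m * (c n * D (term n m) s)) (suc (suc N))
        -- The term with m = 0 is split off: its factor `num 0` is 0, and every other m is a
        -- successor that can be lowered.
        ≡⟨ conv-last (λ n m → num m * (c n * D (term n m) s)) (suc N) ⟩
      0ℚ * (c (suc N) * D (term (suc N) 0) s) + conv (λ n m → num (suc m) * (c n * D (term n (suc m)) s)) (suc N)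
        ≡⟨ cong₂ _+_ (*-zeroˡ (c (suc N) * D (term (suc N) 0) s)) (conv-cong (suc N) lower) ⟩
      0ℚ + conv (λ n m → k * (c n * D (term n m) s) + - 1ℚ * (e n * term n m s)) (suc N)
        ≡⟨ +-identityˡ _ ⟩
      conv (λ n m → k * (c n * D (term n m) s) + - 1ℚ * (e n * term n m s)) (suc N)
        ≡⟨ conv-+ (λ n m → k * (c n * D (term n m) s)) (λ n m → - 1ℚ * (e n * term n m s)) (suc N) ⟩
      conv (λ n m → k * (c n * D (term n m) s)) (suc N) + conv (λ n m → - 1ℚ * (e n * term n m s)) (suc N)
        ≡⟨ cong₂ _+_ (conv-* k (λ n m → c n * D (term n m) s) (suc N)) (conv-* (- 1ℚ) (λ n m → e n * term n m s) (suc N)) ⟩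
      k * conv (λ n m → c n * D (term n m) s) (suc N) + - 1ℚ * weighted e N s
        ≡⟨ cong (λ x → k * x + - 1ℚ * weighted e N s) (sym (weighted-mulLin 1ℚ (- q) c N s)) ⟩
      k * D (weighted c N) s + - 1ℚ * weighted e N s ∎

-- The weight n kills the term n = 0. In the others n can be lowered by `term-sucˡ`, where (n+1) ·
-- (n+y)/(n+1) = n + y.
weighted-num-step : ∀ N s →
  mulLin 1ℚ (- inv (suc N)) (weighted num (suc N)) s ≡ weighted num N s + shift (weighted (λ _ → 1ℚ) N) s
weighted-num-step N s = begin-equality
  D (weighted num (suc N)) s
    ≡⟨ weighted-mulLin 1ℚ (- inv (suc N)) num (suc N) s ⟩
  0ℚ * D (term 0 (suc N)) s + conv (λ n m → num (suc n) * D (term (suc n) m) s) (suc N)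
    ≡⟨ cong₂ _+_ (*-zeroˡ (D (term 0 (suc N)) s)) (conv-cong (suc N) raise) ⟩
  0ℚ + conv (λ n m → num n * term n m s + 1ℚ * shift (term n m) s) (suc N)
    ≡⟨ +-identityˡ _ ⟩
  conv (λ n m → num n * term n m s + 1ℚ * shift (term n m) s) (suc N)
    ≡⟨ conv-+ (λ n m → num n * term n m s) (λ n m → 1ℚ * shift (term n m) s) (suc N) ⟩
  weighted num N s + conv (λ n m → 1ℚ * shift (term n m) s) (suc N)
    ≡⟨ cong (_+_ (weighted num N s)) (conv-ext (suc N) (λ n m → shift-one n m s)) ⟩
  weighted num N s + conv (λ n m → shift (λ t → 1ℚ * term n m t) s) (suc N)
    ≡⟨ cong (_+_ (weighted num N s)) (sym (shift-conv (λ n m t → 1ℚ * term n m t) (suc N) s)) ⟩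
  weighted num N s + shift (weighted (λ _ → 1ℚ) N) s ∎
  where
  D = mulLin 1ℚ (- inv (suc N))
  shift-one : ∀ n m s → 1ℚ * shift (term n m) s ≡ shift (λ t → 1ℚ * term n m t) s
  shift-one n m zero = *-zeroʳ 1ℚ
  shift-one n m (suc s) = refl
  raise : ∀ n m → suc (n ℕ.+ m) ≡ suc N →
    num (suc n) * D (term (suc n) m) s ≡ num n * term n m s + 1ℚ * shift (term n m) s
  raise n m refl = begin-equality
    num (suc n) * D (term (suc n) m) s
      ≡⟨ cong (_*_ (num (suc n))) (term-sucˡ n m s) ⟩
    num (suc n) * (inv (suc n) * num n * term n m s + inv (suc n) * shift (term n m) s)
      ≡⟨ expand (num (suc n)) (inv (suc n)) (num n) (term n m s) (shift (term n m) s) ⟩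
    num (suc n) * inv (suc n) * (num n * term n m s + shift (term n m) s)
      ≡⟨ cong (_* (num n * term n m s + shift (term n m) s)) (num*inv n) ⟩
    1ℚ * (num n * term n m s + shift (term n m) s)
      ≡⟨ unit (num n * term n m s) (shift (term n m) s) ⟩
    num n * term n m s + 1ℚ * shift (term n m) s ∎
    where
    expand : ∀ k i a t t′ → k * (i * a * t + i * t′) ≡ k * i * (a * t + t′)
    expand = solve-∀ ring
    unit : ∀ x y → 1ℚ * (x + y) ≡ x + 1ℚ * y
    unit = solve-∀ ring

weighted-one-step : ∀ N s →
  mulLin 1ℚ (- inv (suc N)) (weighted (λ _ → 1ℚ) (suc N)) s ≡ weighted (λ _ → 1ℚ) N s
weighted-one-step N s = begin-equality
  D (S (suc N)) s
    ≡⟨ weighted-step (λ _ → 1ℚ) num (λ n → sym (*-identityʳ (num n))) N s ⟩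
  D (S N) s + q * (D (weighted num (suc N)) s - weighted num N s)
    ≡⟨ cong (λ x → D (S N) s + q * (x - weighted num N s)) (weighted-num-step N s) ⟩
  D (S N) s + q * (weighted num N s + shift (S N) s - weighted num N s)
    ≡⟨ collapse q (S N s) (shift (S N) s) (weighted num N s) ⟩
  S N s ∎
  where
  q = inv (suc N)
  D = mulLin 1ℚ (- q)
  S = weighted (λ _ → 1ℚ)
  collapse : ∀ q x x′ y → 1ℚ * x + - q * x′ + q * (y + x′ - y) ≡ x
  collapse = solve-∀ ring

-- The coefficients of P_N and their recurrence.

-- the coefficient of x^k in -x/(n-x)
coef : ℕ → ℕ → ℚ
coef zero zero = 1ℚ
coef zero (suc n) = 0ℚ
coef (suc k) zero = 0ℚ
coef (suc k) (suc n) = - powℚ (inv (suc n)) (suc k)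

num*powℚ : ∀ n k → num (suc n) * - powℚ (inv (suc n)) (suc k) ≡ - powℚ (inv (suc n)) k
num*powℚ n k = trans (regroup (num (suc n)) (inv (suc n)) (powℚ (inv (suc n)) k))
  (trans (cong (_* - powℚ (inv (suc n)) k) (num*inv n)) (*-identityˡ _))
  where
  regroup : ∀ a i p → a * - (i * p) ≡ a * i * - p
  regroup = solve-∀ ring

-- Coefficientwise form of n c = x (c - 1) for c = -x/(n-x); the term -x enters only in degree 1,
-- which is `coef-one`.
coef-suc : ∀ k n → coef (suc k) n ≡ num n * coef (suc (suc k)) n
coef-suc k zero = refl
coef-suc k (suc n) = sym (num*powℚ n (suc k))

coef-one : ∀ n → coef 0 n + - 1ℚ * 1ℚ ≡ num n * coef 1 n
coef-one zero = refl
coef-one (suc n) = sym (num*powℚ n 0)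

-- the coefficient of x^k in P_N
value : ℕ → ℕ → Series
value k = weighted (coef k)

value-step : ∀ k N s →
  mulLin 1ℚ (- inv (suc N)) (value (suc k) (suc N)) s
    ≡ mulLin 1ℚ (- inv (suc N)) (value (suc k) N) s
      + inv (suc N) * (mulLin 1ℚ (- inv (suc N)) (value k (suc N)) s - value k N s)
value-step (suc k) N s = weighted-step (coef (suc (suc k))) (coef (suc k)) (coef-suc k) N s
-- The -1 in `coef-one` adds a multiple of the sum `S` with weights 1. It enters through
-- `D (S (suc N)) s - S N s`, which vanishes by `weighted-one-step`.
value-step zero N s = begin-equality
  D (value 1 (suc N)) s
    ≡⟨ weighted-step (coef 1) e coef-one N s ⟩
  D (value 1 N) s + q * (D (weighted e (suc N)) s - weighted e N s)
    ≡⟨ cong₂ (λ x y → D (value 1 N) s + q * (x - y)) D-e (weighted-e N s) ⟩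
  D (value 1 N) s + q * (D (value 0 (suc N)) s + - 1ℚ * D (S (suc N)) s - (value 0 N s + - 1ℚ * S N s))
    ≡⟨ cong (λ x → D (value 1 N) s + q * (D (value 0 (suc N)) s + - 1ℚ * x - (value 0 N s + - 1ℚ * S N s))) (weighted-one-step N s) ⟩
  D (value 1 N) s + q * (D (value 0 (suc N)) s + - 1ℚ * S N s - (value 0 N s + - 1ℚ * S N s))
    ≡⟨ cong (λ x → D (value 1 N) s + q * x) (cancel (D (value 0 (suc N)) s) (value 0 N s) (S N s)) ⟩
  D (value 1 N) s + q * (D (value 0 (suc N)) s - value 0 N s) ∎
  where
  q = inv (suc N)
  D = mulLin 1ℚ (- q)
  S = weighted (λ _ → 1ℚ)
  e : ℕ → ℚ
  e n = coef 0 n + - 1ℚ * 1ℚ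
  cancel : ∀ x y z → x + - 1ℚ * z - (y + - 1ℚ * z) ≡ x - y
  cancel = solve-∀ ring
  weighted-e : ∀ N s → weighted e N s ≡ value 0 N s + - 1ℚ * S N s
  weighted-e N s = begin-equality
    weighted e N s
      ≡⟨ conv-ext (suc N) (λ n m → distrib (coef 0 n) (term n m s)) ⟩
    conv (λ n m → coef 0 n * term n m s + - 1ℚ * (1ℚ * term n m s)) (suc N)
      ≡⟨ conv-+ (λ n m → coef 0 n * term n m s) (λ n m → - 1ℚ * (1ℚ * term n m s)) (suc N) ⟩
    value 0 N s + conv (λ n m → - 1ℚ * (1ℚ * term n m s)) (suc N)
      ≡⟨ cong (_+_ (value 0 N s)) (conv-* (- 1ℚ) (λ n m → 1ℚ * term n m s) (suc N)) ⟩
    value 0 N s + - 1ℚ * S N s ∎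
    where
    distrib : ∀ x t → (x + - 1ℚ * 1ℚ) * t ≡ x * t + - 1ℚ * (1ℚ * t)
    distrib = solve-∀ ring
  shift-weighted-e : ∀ N s → shift (weighted e N) s ≡ shift (value 0 N) s + - 1ℚ * shift (S N) s
  shift-weighted-e N zero = refl
  shift-weighted-e N (suc s) = weighted-e N s
  D-e : D (weighted e (suc N)) s ≡ D (value 0 (suc N)) s + - 1ℚ * D (S (suc N)) s
  D-e = trans (cong₂ (λ x y → 1ℚ * x + - q * y) (weighted-e (suc N) s) (shift-weighted-e (suc N) s))
    (expand q (value 0 (suc N) s) (S (suc N) s) (shift (value 0 (suc N)) s) (shift (S (suc N)) s))
    where
    expand : ∀ q x y z t → 1ℚ * (x + - 1ℚ * y) + - q * (z + - 1ℚ * t) ≡ 1ℚ * x + - q * z + - 1ℚ * (1ℚ * y + - q * t)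
    expand = solve-∀ ring

-- The coefficient of x^{k+1} in P_{N+1} (1 - q x) = P_N (1 - q x/(1 - q y)), where q = 1/(N+1).
-- Both sides agree after multiplication by 1 - q y, and `geo-inverse` removes that factor.
value-suc : ∀ k N s →
  value (suc k) (suc N) s ≡ value (suc k) N s + inv (suc N) * (value k (suc N) s - geo (inv (suc N)) (value k N) s)
value-suc k N s = begin-equality
  value (suc k) (suc N) s
    ≡⟨ geo-inverse q (value (suc k) (suc N)) s ⟩
  geo q (D (value (suc k) (suc N))) s
    ≡⟨ geo-ext q (λ s → trans (value-step k N s) (sym (D-R s))) s ⟩
  geo q (D R) s
    ≡⟨ sym (geo-inverse q R s) ⟩
  R s ∎
  where
  q = inv (suc N)
  D = mulLin 1ℚ (- q)
  Z = geo q (value k N)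
  R : Series
  R s = value (suc k) N s + q * (value k (suc N) s - Z s)
  shift-R : ∀ s → shift R s ≡ shift (value (suc k) N) s + q * (shift (value k (suc N)) s - shift Z s)
  shift-R zero = zeros q
    where
    zeros : ∀ q → 0ℚ ≡ 0ℚ + q * (0ℚ - 0ℚ)
    zeros = solve-∀ ring
  shift-R (suc s) = refl
  D-R : ∀ s → D R s ≡ D (value (suc k) N) s + q * (D (value k (suc N)) s - value k N s)
  D-R s = begin-equality
    1ℚ * R s + - q * shift R s
      ≡⟨ cong (λ x → 1ℚ * R s + - q * x) (shift-R s) ⟩
    1ℚ * R s + - q * (shift (value (suc k) N) s + q * (shift (value k (suc N)) s - shift Z s))
      ≡⟨ expand q (value (suc k) N s) (value k (suc N) s) (Z s)
           (shift (value (suc k) N) s) (shift (value k (suc N)) s) (shift Z s) ⟩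
    D (value (suc k) N) s + q * (D (value k (suc N)) s - D Z s)
      ≡⟨ cong (λ x → D (value (suc k) N) s + q * (D (value k (suc N)) s - x)) (geo-cancel q (value k N) s) ⟩
    D (value (suc k) N) s + q * (D (value k (suc N)) s - value k N s) ∎
    where
    expand : ∀ q x y z x′ y′ z′ → 1ℚ * (x + q * (y - z)) + - q * (x′ + q * (y′ - z′))
      ≡ 1ℚ * x + - q * x′ + q * (1ℚ * y + - q * y′ - (1ℚ * z + - q * z′))
    expand = solve-∀ ring

geo-expand : ∀ q f s → geo q f s - f s ≡ conv (λ b t → powℚ q (suc b) * f t) s
geo-expand q f zero = +-inverseʳ (f 0)
geo-expand q f (suc s) = begin-equality
  f (suc s) + q * geo q f s - f (suc s)
    ≡⟨ regroup (f (suc s)) q (geo q f s) (f s) ⟩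
  q * 1ℚ * f s + q * (geo q f s - f s)
    ≡⟨ cong (λ x → q * 1ℚ * f s + q * x) (geo-expand q f s) ⟩
  q * 1ℚ * f s + q * conv (λ b t → powℚ q (suc b) * f t) s
    ≡⟨ cong (_+_ (q * 1ℚ * f s)) (sym (conv-* q (λ b t → powℚ q (suc b) * f t) s)) ⟩
  q * 1ℚ * f s + conv (λ b t → q * (powℚ q (suc b) * f t)) s
    ≡⟨ cong (_+_ (q * 1ℚ * f s)) (conv-ext s (λ b t → sym (*-assoc q (powℚ q (suc b)) (f t)))) ⟩
  q * 1ℚ * f s + conv (λ b t → powℚ q (suc (suc b)) * f t) s ∎
  where
  regroup : ∀ x q g y → x + q * g - x ≡ q * 1ℚ * y + q * (g - y)
  regroup = solve-∀ ring

value-zero : ∀ N s → value 0 N s ≡ rising 0 s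
value-zero N s = begin-equality
  1ℚ * rising 0 s + conv (λ n m → 0ℚ * term (suc n) m s) N
    ≡⟨ cong (_+_ (1ℚ * rising 0 s)) (trans (conv-ext N (λ n m → *-zeroˡ (term (suc n) m s))) (conv-0 N)) ⟩
  1ℚ * rising 0 s + 0ℚ
    ≡⟨ unit (rising 0 s) ⟩
  rising 0 s ∎
  where
  unit : ∀ x → 1ℚ * x + 0ℚ ≡ x
  unit = solve-∀ ring

-- Unrolling `value-suc` in k expands 1/(1 - q x). With `geo-expand` it becomes P_{N+1} = P_N (1 -
-- Σ_{a,b≥1} (q x)^a (q y)^b).
value-recurrence : ∀ k N s → value k (suc N) s
  ≡ value k N s - conv (λ a l → powℚ (inv (suc N)) (suc a) * (geo (inv (suc N)) (value l N) s - value l N s)) k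
value-recurrence zero N s = trans (value-zero (suc N) s) (trans (sym (value-zero N s)) (unit (value 0 N s)))
  where
  unit : ∀ x → x ≡ x - 0ℚ
  unit = solve-∀ ring
value-recurrence (suc k) N s = begin-equality
  value (suc k) (suc N) s
    ≡⟨ value-suc k N s ⟩
  value (suc k) N s + q * (value k (suc N) s - geo q (value k N) s)
    ≡⟨ cong (λ x → value (suc k) N s + q * (x - geo q (value k N) s)) (value-recurrence k N s) ⟩
  value (suc k) N s + q * (value k N s - X - geo q (value k N) s)
    ≡⟨ regroup (value (suc k) N s) q (value k N s) X (geo q (value k N) s) ⟩
  value (suc k) N s - (q * 1ℚ * Y k + q * X)
    ≡⟨ cong (λ x → value (suc k) N s - (q * 1ℚ * Y k + x)) (sym (conv-* q (λ a l → powℚ q (suc a) * Y l) k)) ⟩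
  value (suc k) N s - (q * 1ℚ * Y k + conv (λ a l → q * (powℚ q (suc a) * Y l)) k)
    ≡⟨ cong (λ x → value (suc k) N s - (q * 1ℚ * Y k + x)) (conv-ext k (λ a l → sym (*-assoc q (powℚ q (suc a)) (Y l)))) ⟩
  value (suc k) N s - conv (λ a l → powℚ q (suc a) * Y l) (suc k) ∎
  where
  q = inv (suc N)
  Y : ℕ → ℚ
  Y l = geo q (value l N) s - value l N s
  X = conv (λ a l → powℚ q (suc a) * Y l) k
  regroup : ∀ x q y c g → x + q * (y - c - g) ≡ x - (q * 1ℚ * (g - y) + q * c)
  regroup = solve-∀ ring

-- Sums over compositions and over pairs of compositions.

sumℚ-++ : ∀ xs ys → sumℚ (xs ++ ys) ≡ sumℚ xs + sumℚ ys
sumℚ-++ [] ys = sym (+-identityˡ (sumℚ ys))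
sumℚ-++ (x ∷ xs) ys = trans (cong (_+_ x) (sumℚ-++ xs ys)) (sym (+-assoc x (sumℚ xs) (sumℚ ys)))

module _ {A : Set} where

  sumℚ-concat : ∀ (g : A → List ℚ) xs → sumℚ (concat (map g xs)) ≡ sumℚ (map (λ x → sumℚ (g x)) xs)
  sumℚ-concat g [] = refl
  sumℚ-concat g (x ∷ xs) = trans (sumℚ-++ (g x) (concat (map g xs))) (cong (_+_ (sumℚ (g x))) (sumℚ-concat g xs))

  sumℚ-ext : ∀ {f g : A → ℚ} xs → (∀ x → f x ≡ g x) → sumℚ (map f xs) ≡ sumℚ (map g xs)
  sumℚ-ext xs h = cong sumℚ (Listₚ.map-cong h xs)

  sumℚ-+ : ∀ (f g : A → ℚ) xs → sumℚ (map (λ x → f x + g x) xs) ≡ sumℚ (map f xs) + sumℚ (map g xs)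
  sumℚ-+ f g [] = refl
  sumℚ-+ f g (x ∷ xs) = trans (cong (_+_ (f x + g x)) (sumℚ-+ f g xs)) (interchange (f x) (g x) _ _)

  sumℚ-* : ∀ c (f : A → ℚ) xs → sumℚ (map (λ x → c * f x) xs) ≡ c * sumℚ (map f xs)
  sumℚ-* c f [] = sym (*-zeroʳ c)
  sumℚ-* c f (x ∷ xs) = trans (cong (_+_ (c * f x)) (sumℚ-* c f xs)) (sym (*-distribˡ-+ c (f x) _))

  sumℚ-0 : ∀ (xs : List A) → sumℚ (map (λ _ → 0ℚ) xs) ≡ 0ℚ
  sumℚ-0 [] = refl
  sumℚ-0 (x ∷ xs) = trans (+-identityˡ _) (sumℚ-0 xs)

  sumℚ-conv : ∀ (F : A → ℕ → ℕ → ℚ) xs n →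
    sumℚ (map (λ x → conv (F x) n) xs) ≡ conv (λ a m → sumℚ (map (λ x → F x a m) xs)) n
  sumℚ-conv F xs zero = sumℚ-0 xs
  sumℚ-conv F xs (suc n) = trans (sumℚ-+ (λ x → F x 0 n) (λ x → conv (λ a → F x (suc a)) n) xs)
    (cong (_+_ (sumℚ (map (λ x → F x 0 n) xs))) (sumℚ-conv (λ x a → F x (suc a)) xs n))

sumℚ-applyUpTo : ∀ {A : Set} (h : A → ℚ) (f : ℕ → A) (g : ℕ → ℕ → ℚ) n →
  (∀ a → h (f a) ≡ g a (n ℕ.∸ suc a)) → sumℚ (map h (applyUpTo f n)) ≡ conv g n
sumℚ-applyUpTo h f g zero _ = refl
sumℚ-applyUpTo h f g (suc n) eq =
  cong₂ _+_ (eq 0) (sumℚ-applyUpTo h (λ a → f (suc a)) (λ a → g (suc a)) n (λ a → eq (suc a)))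

compSum : ℕ → ℕ → (List ℕ → ℚ) → ℚ
compSum n j F = sumℚ (map F (comps n j))

-- The earlier clauses of `comps` split on n, so its last clause does not reduce for a variable n;
-- the two cases make it available.
comps-suc : ∀ n j → comps n (suc j) ≡ concat (map (λ a → map (suc a ∷_) (comps (n ℕ.∸ suc a) j)) (upTo n))
comps-suc zero j = refl
comps-suc (suc n) j = refl

compSum-suc : ∀ n j F → compSum n (suc j) F ≡ conv (λ a m → compSum m j (λ l → F (suc a ∷ l))) n
compSum-suc n j F = begin-equality
  sumℚ (map F (comps n (suc j)))
    ≡⟨ cong (λ xs → sumℚ (map F xs)) (comps-suc n j) ⟩
  sumℚ (map F (concat (map heads (upTo n))))
    ≡⟨ cong sumℚ (sym (Listₚ.concat-map {f = F} (map heads (upTo n)))) ⟩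
  sumℚ (concat (map (map F) (map heads (upTo n))))
    ≡⟨ cong (λ xs → sumℚ (concat xs)) (sym (Listₚ.map-∘ (upTo n))) ⟩
  sumℚ (concat (map (λ a → map F (heads a)) (upTo n)))
    ≡⟨ sumℚ-concat (λ a → map F (heads a)) (upTo n) ⟩
  sumℚ (map (λ a → sumℚ (map F (heads a))) (upTo n))
    ≡⟨ sumℚ-applyUpTo (λ a → sumℚ (map F (heads a))) id _ n
         (λ a → cong sumℚ (sym (Listₚ.map-∘ (comps (n ℕ.∸ suc a) j)))) ⟩
  conv (λ a m → compSum m j (λ l → F (suc a ∷ l))) n ∎
  where
  heads : ℕ → List (List ℕ)
  heads a = map (suc a ∷_) (comps (n ℕ.∸ suc a) j)

-- The restriction to lists of length j matters: `zipWith` truncates, so `reverse-zipWith` holds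
-- only for lists of equal length.
compSum-cong : ∀ j {F G} n → (∀ l → length l ≡ j → F l ≡ G l) → compSum n j F ≡ compSum n j G
compSum-cong zero zero h = cong (_+ 0ℚ) (h [] refl)
compSum-cong zero (suc n) h = refl
compSum-cong (suc j) {F} {G} n h = begin-equality
  compSum n (suc j) F
    ≡⟨ compSum-suc n j F ⟩
  conv (λ a m → compSum m j (λ l → F (suc a ∷ l))) n
    ≡⟨ conv-ext n (λ a m → compSum-cong j m (λ l e → h (suc a ∷ l) (cong suc e))) ⟩
  conv (λ a m → compSum m j (λ l → G (suc a ∷ l))) n
    ≡⟨ sym (compSum-suc n j G) ⟩
  compSum n (suc j) G ∎

-- Peeling off the last part instead of the first: below the first part this is the induction
-- hypothesis, and `conv-swap` brings the last part outside.
compSum-∷ʳ : ∀ j n F → compSum n (suc j) F ≡ conv (λ a m → compSum m j (λ l → F (l ++ [ suc a ]))) n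
compSum-∷ʳ zero n F = trans (compSum-suc n 0 F) (conv-ext n singleton)
  where
  singleton : ∀ a m → compSum m 0 (λ l → F (suc a ∷ l)) ≡ compSum m 0 (λ l → F (l ++ [ suc a ]))
  singleton a zero = refl
  singleton a (suc m) = refl
compSum-∷ʳ (suc j) n F = begin-equality
  compSum n (suc (suc j)) F
    ≡⟨ compSum-suc n (suc j) F ⟩
  conv (λ a m → compSum m (suc j) (λ l → F (suc a ∷ l))) n
    ≡⟨ conv-ext n (λ a m → compSum-∷ʳ j m (λ l → F (suc a ∷ l))) ⟩
  conv (λ a → conv (λ b m → compSum m j (λ l → F (suc a ∷ l ++ [ suc b ])))) n
    ≡⟨ conv-swap (λ a b m → compSum m j (λ l → F (suc a ∷ l ++ [ suc b ]))) n ⟩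
  conv (λ b → conv (λ a m → compSum m j (λ l → F (suc a ∷ l ++ [ suc b ])))) n
    ≡⟨ conv-ext n (λ b m → sym (compSum-suc m j (λ l → F (l ++ [ suc b ])))) ⟩
  conv (λ b m → compSum m (suc j) (λ l → F (l ++ [ suc b ]))) n ∎

compSum-reverse : ∀ j n F → compSum n j (F ∘ reverse) ≡ compSum n j F
compSum-reverse zero zero F = refl
compSum-reverse zero (suc n) F = refl
compSum-reverse (suc j) n F = begin-equality
  compSum n (suc j) (F ∘ reverse)
    ≡⟨ compSum-suc n j (F ∘ reverse) ⟩
  conv (λ a m → compSum m j (λ l → F (reverse (suc a ∷ l)))) n
    ≡⟨ conv-ext n (λ a m → sumℚ-ext (comps m j) (λ l → cong F (Listₚ.unfold-reverse (suc a) l))) ⟩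
  conv (λ a m → compSum m j (λ l → F (reverse l ++ [ suc a ]))) n
    ≡⟨ conv-ext n (λ a m → compSum-reverse j m (λ l → F (l ++ [ suc a ]))) ⟩
  conv (λ a m → compSum m j (λ l → F (l ++ [ suc a ]))) n
    ≡⟨ sym (compSum-∷ʳ j n F) ⟩
  compSum n (suc j) F ∎

zipWith-∷ʳ : ∀ {A B C : Set} (f : A → B → C) xs ys x y → length xs ≡ length ys →
  zipWith f (xs ++ [ x ]) (ys ++ [ y ]) ≡ zipWith f xs ys ++ [ f x y ]
zipWith-∷ʳ f [] [] x y _ = refl
zipWith-∷ʳ f (z ∷ xs) (w ∷ ys) x y e = cong (f z w ∷_) (zipWith-∷ʳ f xs ys x y (ℕₚ.suc-injective e))

reverse-zipWith : ∀ {A B C : Set} (f : A → B → C) xs ys → length xs ≡ length ys →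
  reverse (zipWith f xs ys) ≡ zipWith f (reverse xs) (reverse ys)
reverse-zipWith f [] [] _ = refl
reverse-zipWith f (x ∷ xs) (y ∷ ys) e =
  trans (Listₚ.unfold-reverse (f x y) (zipWith f xs ys))
  (trans (cong (_++ [ f x y ]) (reverse-zipWith f xs ys |xs|≡|ys|))
  (trans (sym (zipWith-∷ʳ f (reverse xs) (reverse ys) x y
           (trans (Listₚ.length-reverse xs) (trans |xs|≡|ys| (sym (Listₚ.length-reverse ys))))))
         (sym (cong₂ (zipWith f) (Listₚ.unfold-reverse x xs) (Listₚ.unfold-reverse y ys)))))
  where |xs|≡|ys| = ℕₚ.suc-injective e

pairSum : ℕ → ℕ → ℕ → (List ℕ → ℚ) → ℚ
pairSum k r j F = compSum k j (λ a → compSum r j (λ b → F (zipWith ℕ._+_ a b)))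

-- Removes the reversal inside `ζ≤`: reversing a and b simultaneously permutes the pairs of
-- compositions, and a + b is reversed along with them.
pairSum-reverse : ∀ k r j F → pairSum k r j (F ∘ reverse) ≡ pairSum k r j F
pairSum-reverse k r j F = begin-equality
  pairSum k r j (F ∘ reverse)
    ≡⟨ compSum-cong j k (λ a |a| → compSum-cong j r (λ b |b| →
         cong F (reverse-zipWith ℕ._+_ a b (trans |a| (sym |b|))))) ⟩
  compSum k j (λ a → compSum r j (λ b → F (zipWith ℕ._+_ (reverse a) (reverse b))))
    ≡⟨ sumℚ-ext (comps k j) (λ a → compSum-reverse j r (λ b → F (zipWith ℕ._+_ (reverse a) b))) ⟩
  compSum k j (λ a → compSum r j (λ b → F (zipWith ℕ._+_ (reverse a) b)))
    ≡⟨ compSum-reverse j k (λ a → compSum r j (λ b → F (zipWith ℕ._+_ a b))) ⟩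
  pairSum k r j F ∎

pairSum-suc : ∀ k r j F → pairSum k r (suc j) F
  ≡ conv (λ a l → conv (λ b t → pairSum l t j (λ c → F (suc a ℕ.+ suc b ∷ c))) r) k
pairSum-suc k r j F = begin-equality
  pairSum k r (suc j) F
    ≡⟨ compSum-suc k j (λ a → compSum r (suc j) (λ b → F (zipWith ℕ._+_ a b))) ⟩
  conv (λ a l → compSum l j (λ a′ → compSum r (suc j) (λ b → F (zipWith ℕ._+_ (suc a ∷ a′) b)))) k
    ≡⟨ conv-ext k (λ a l → trans
         (sumℚ-ext (comps l j) (λ a′ → compSum-suc r j (λ b → F (zipWith ℕ._+_ (suc a ∷ a′) b))))
         (sumℚ-conv (λ a′ b t → compSum t j (λ b′ → F (suc a ℕ.+ suc b ∷ zipWith ℕ._+_ a′ b′))) (comps l j) r)) ⟩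
  conv (λ a l → conv (λ b t → pairSum l t j (λ c → F (suc a ℕ.+ suc b ∷ c))) r) k ∎

pairSum-+ : ∀ k r j F G → pairSum k r j (λ l → F l + G l) ≡ pairSum k r j F + pairSum k r j G
pairSum-+ k r j F G = trans
  (sumℚ-ext (comps k j) (λ a → sumℚ-+ (λ b → F (zipWith ℕ._+_ a b)) (λ b → G (zipWith ℕ._+_ a b)) (comps r j)))
  (sumℚ-+ (λ a → compSum r j (λ b → F (zipWith ℕ._+_ a b))) (λ a → compSum r j (λ b → G (zipWith ℕ._+_ a b))) (comps k j))

pairSum-* : ∀ k r j c F → pairSum k r j (λ l → c * F l) ≡ c * pairSum k r j F
pairSum-* k r j c F = trans
  (sumℚ-ext (comps k j) (λ a → sumℚ-* c (λ b → F (zipWith ℕ._+_ a b)) (comps r j)))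
  (sumℚ-* c (λ a → compSum r j (λ b → F (zipWith ℕ._+_ a b))) (comps k j))

pairSum-0 : ∀ k r j → pairSum k r j (λ _ → 0ℚ) ≡ 0ℚ
pairSum-0 k r j = trans (sumℚ-ext (comps k j) (λ _ → sumℚ-0 (comps r j))) (sumℚ-0 (comps k j))

-- The truncated right-hand side, layered by depth.

powℚ-+ : ∀ q a b → powℚ q (a ℕ.+ b) ≡ powℚ q a * powℚ q b
powℚ-+ q zero b = sym (*-identityˡ (powℚ q b))
powℚ-+ q (suc a) b = trans (cong (_*_ q) (powℚ-+ q a b)) (sym (*-assoc q (powℚ q a) (powℚ q b)))

layer : ℕ → ℕ → ℕ → ℕ → ℚ
layer N k r j = pairSum k r j (Zrev N)

-- Multiplication of a double series in x and y by Σ_{a,b≥1} (q x)^a (q y)^b.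
conv₂ : ℚ → (ℕ → ℕ → ℚ) → ℕ → ℕ → ℚ
conv₂ q f k r = conv (λ a l → conv (λ b t → powℚ q (suc a) * (powℚ q (suc b) * f l t)) r) k

conv₂-cong : ∀ q {f g} k r → (∀ l t → l ℕ.< k → t ℕ.< r → f l t ≡ g l t) → conv₂ q f k r ≡ conv₂ q g k r
conv₂-cong q k r h = conv-cong k (λ a l l<k → conv-cong r (λ b t t<r →
  cong (λ x → powℚ q (suc a) * (powℚ q (suc b) * x)) (h l t (below a l<k) (below b t<r))))
  where
  below : ∀ a {l k} → suc (a ℕ.+ l) ≡ k → l ℕ.< k
  below a {l} refl = ℕ.s≤s (ℕₚ.m≤n+m l a)

conv₂-0 : ∀ q k r → conv₂ q (λ _ _ → 0ℚ) k r ≡ 0ℚ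
conv₂-0 q k r = trans (conv-ext k (λ a l → trans (conv-ext r (λ b t → zeros (powℚ q (suc a)) (powℚ q (suc b)))) (conv-0 r))) (conv-0 k)
  where
  zeros : ∀ a b → a * (b * 0ℚ) ≡ 0ℚ
  zeros = solve-∀ ring

conv₂-linear : ∀ q f g k r → conv₂ q (λ l t → f l t - g l t) k r ≡ conv₂ q f k r - conv₂ q g k r
conv₂-linear q f g k r = begin-equality
  conv₂ q (λ l t → f l t - g l t) k r
    ≡⟨ conv-ext k (λ a l → trans
         (conv-ext r (λ b t → expand (powℚ q (suc a)) (powℚ q (suc b)) (f l t) (g l t)))
         (trans (conv-+ (λ b t → F a l b t) (λ b t → - 1ℚ * G a l b t) r)
                (cong (_+_ (conv (F a l) r)) (conv-* (- 1ℚ) (G a l) r)))) ⟩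
  conv (λ a l → conv (F a l) r + - 1ℚ * conv (G a l) r) k
    ≡⟨ conv-+ (λ a l → conv (F a l) r) (λ a l → - 1ℚ * conv (G a l) r) k ⟩
  conv₂ q f k r + conv (λ a l → - 1ℚ * conv (G a l) r) k
    ≡⟨ cong (_+_ (conv₂ q f k r)) (conv-* (- 1ℚ) (λ a l → conv (G a l) r) k) ⟩
  conv₂ q f k r + - 1ℚ * conv₂ q g k r
    ≡⟨ minus (conv₂ q f k r) (conv₂ q g k r) ⟩
  conv₂ q f k r - conv₂ q g k r ∎
  where
  F G : ℕ → ℕ → ℕ → ℕ → ℚ
  F a l b t = powℚ q (suc a) * (powℚ q (suc b) * f l t)
  G a l b t = powℚ q (suc a) * (powℚ q (suc b) * g l t)
  expand : ∀ a b x y → a * (b * (x - y)) ≡ a * (b * x) + - 1ℚ * (a * (b * y))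
  expand = solve-∀ ring
  minus : ∀ x y → x + - 1ℚ * y ≡ x - y
  minus = solve-∀ ring

-- Either the largest summation variable is at most N, or it is N + 1 and its exponent a + b factors
-- as q^a q^b, leaving a sum of depth one less.
layer-suc : ∀ N k r j → layer (suc N) k r (suc j) ≡ layer N k r (suc j) + conv₂ (inv (suc N)) (λ l t → layer N l t j) k r
layer-suc N k r j = begin-equality
  layer (suc N) k r (suc j)
    ≡⟨ pairSum-suc k r j (Zrev (suc N)) ⟩
  conv (λ a l → conv (λ b t → pairSum l t j (λ c → Zrev N (suc a ℕ.+ suc b ∷ c) + powℚ q (suc a ℕ.+ suc b) * Zrev N c)) r) k
    ≡⟨ conv-ext k (λ a l → trans (conv-ext r (λ b t → split a l b t)) (conv-+ (F a l) (G a l) r)) ⟩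
  conv (λ a l → conv (F a l) r + conv (G a l) r) k
    ≡⟨ conv-+ (λ a l → conv (F a l) r) (λ a l → conv (G a l) r) k ⟩
  conv (λ a l → conv (F a l) r) k + conv (λ a l → conv (G a l) r) k
    ≡⟨ cong (_+ conv (λ a l → conv (G a l) r) k) (sym (pairSum-suc k r j (Zrev N))) ⟩
  layer N k r (suc j) + conv₂ q (λ l t → layer N l t j) k r ∎
  where
  q = inv (suc N)
  F G : ℕ → ℕ → ℕ → ℕ → ℚ
  F a l b t = pairSum l t j (λ c → Zrev N (suc a ℕ.+ suc b ∷ c))
  G a l b t = powℚ q (suc a) * (powℚ q (suc b) * layer N l t j)
  split : ∀ a l b t →
    pairSum l t j (λ c → Zrev N (suc a ℕ.+ suc b ∷ c) + powℚ q (suc a ℕ.+ suc b) * Zrev N c) ≡ F a l b t + G a l b t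
  split a l b t = begin-equality
    pairSum l t j (λ c → Zrev N (suc a ℕ.+ suc b ∷ c) + powℚ q (suc a ℕ.+ suc b) * Zrev N c)
      ≡⟨ pairSum-+ l t j (λ c → Zrev N (suc a ℕ.+ suc b ∷ c)) (λ c → powℚ q (suc a ℕ.+ suc b) * Zrev N c) ⟩
    F a l b t + pairSum l t j (λ c → powℚ q (suc a ℕ.+ suc b) * Zrev N c)
      ≡⟨ cong (_+_ (F a l b t)) (pairSum-* l t j (powℚ q (suc a ℕ.+ suc b)) (Zrev N)) ⟩
    F a l b t + powℚ q (suc a ℕ.+ suc b) * layer N l t j
      ≡⟨ cong (λ x → F a l b t + x * layer N l t j) (powℚ-+ q (suc a) (suc b)) ⟩
    F a l b t + powℚ q (suc a) * powℚ q (suc b) * layer N l t j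
      ≡⟨ cong (_+_ (F a l b t)) (*-assoc (powℚ q (suc a)) (powℚ q (suc b)) (layer N l t j)) ⟩
    F a l b t + G a l b t ∎

layer-zero : ∀ N k r → layer N k r 0 ≡ value k 0 r
layer-zero N zero zero = refl
layer-zero N zero (suc r) = refl
layer-zero N (suc k) zero = refl
layer-zero N (suc k) (suc r) = refl

layer-empty : ∀ k r j → layer 0 k r (suc j) ≡ 0ℚ
layer-empty k r j = trans (pairSum-suc k r j (Zrev 0))
  (trans (conv-ext k (λ a l → trans (conv-ext r (λ b t → pairSum-0 l t j)) (conv-0 r))) (conv-0 k))

-- The nested form f 0 - (f 1 - ...) puts the sign change at each loss of depth, matching the minus
-- sign in `value-conv₂`.
altSum : (ℕ → ℚ) → ℕ → ℚ
altSum f zero = 0ℚ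
altSum f (suc J) = f 0 - altSum (λ j → f (suc j)) J

altSum-ext : ∀ {f g} J → (∀ j → f j ≡ g j) → altSum f J ≡ altSum g J
altSum-ext zero h = refl
altSum-ext (suc J) h = cong₂ _-_ (h 0) (altSum-ext J (λ j → h (suc j)))

altSum-0 : ∀ J → altSum (λ _ → 0ℚ) J ≡ 0ℚ
altSum-0 zero = refl
altSum-0 (suc J) = cong (_-_ 0ℚ) (altSum-0 J)

altSum-+ : ∀ f g J → altSum (λ j → f j + g j) J ≡ altSum f J + altSum g J
altSum-+ f g zero = refl
altSum-+ f g (suc J) = trans (cong (_-_ (f 0 + g 0)) (altSum-+ (λ j → f (suc j)) (λ j → g (suc j)) J))
  (regroup (f 0) (g 0) (altSum (λ j → f (suc j)) J) (altSum (λ j → g (suc j)) J))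
  where
  regroup : ∀ a b c d → a + b - (c + d) ≡ a - c + (b - d)
  regroup = solve-∀ ring

altSum-conv₂ : ∀ q (f : ℕ → ℕ → ℕ → ℚ) k r J →
  altSum (λ j → conv₂ q (λ l t → f l t j) k r) J ≡ conv₂ q (λ l t → altSum (f l t) J) k r
altSum-conv₂ q f k r zero = sym (conv₂-0 q k r)
altSum-conv₂ q f k r (suc J) = trans
  (cong (_-_ (conv₂ q (λ l t → f l t 0) k r)) (altSum-conv₂ q (λ l t j → f l t (suc j)) k r J))
  (sym (conv₂-linear q (λ l t → f l t 0) (λ l t → altSum (λ j → f l t (suc j)) J) k r))

value-conv₂ : ∀ k N r → value k (suc N) r ≡ value k N r - conv₂ (inv (suc N)) (λ l t → value l N t) k r
value-conv₂ k N r = trans (value-recurrence k N r) (cong (_-_ (value k N r)) (conv-ext k (λ a l →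
  trans (cong (_*_ (powℚ q (suc a))) (geo-expand q (value l N) r))
        (sym (conv-* (powℚ q (suc a)) (λ b t → powℚ q (suc b) * value l N t) r)))))
  where q = inv (suc N)

-- Induction on N: by `layer-suc` the alternating sum obeys the recurrence of P_N. A step loses one
-- depth, but it also lowers both k and r, so min(l, t) ≤ J - 1 and the bound on the depth is
-- preserved.
altSum-layer : ∀ N J k r → k ℕ.⊓ r ℕ.≤ J → altSum (layer N k r) (suc J) ≡ value k N r
altSum-layer zero J k r _ = begin-equality
  layer 0 k r 0 - altSum (λ j → layer 0 k r (suc j)) J
    ≡⟨ cong₂ _-_ (layer-zero 0 k r) (trans (altSum-ext J (layer-empty k r)) (altSum-0 J)) ⟩
  value k 0 r - 0ℚ
    ≡⟨ unit (value k 0 r) ⟩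
  value k 0 r ∎
  where
  unit : ∀ x → x - 0ℚ ≡ x
  unit = solve-∀ ring
altSum-layer (suc N) J k r k⊓r≤J = begin-equality
  layer (suc N) k r 0 - altSum (λ j → layer (suc N) k r (suc j)) J
    ≡⟨ cong₂ _-_ (trans (layer-zero (suc N) k r) (sym (layer-zero N k r)))
         (trans (altSum-ext J (layer-suc N k r))
                (altSum-+ (λ j → layer N k r (suc j)) (λ j → conv₂ q (λ l t → layer N l t j) k r) J)) ⟩
  layer N k r 0 - (altSum (λ j → layer N k r (suc j)) J + altSum (λ j → conv₂ q (λ l t → layer N l t j) k r) J)
    ≡⟨ regroup (layer N k r 0) (altSum (λ j → layer N k r (suc j)) J) _ ⟩
  altSum (layer N k r) (suc J) - altSum (λ j → conv₂ q (λ l t → layer N l t j) k r) J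
    ≡⟨ cong₂ _-_ (altSum-layer N J k r k⊓r≤J) (altSum-conv₂ q (λ l t → layer N l t) k r J) ⟩
  value k N r - conv₂ q (λ l t → altSum (layer N l t) J) k r
    ≡⟨ cong (_-_ (value k N r)) (conv₂-cong q k r inner) ⟩
  value k N r - conv₂ q (λ l t → value l N t) k r
    ≡⟨ sym (value-conv₂ k N r) ⟩
  value k (suc N) r ∎
  where
  q = inv (suc N)
  regroup : ∀ a b c → a - (b + c) ≡ a - b - c
  regroup = solve-∀ ring
  inner : ∀ l t → l ℕ.< k → t ℕ.< r → altSum (layer N l t) J ≡ value l N t
  inner l t l<k t<r = below J (ℕₚ.≤-trans (ℕₚ.⊓-mono-≤ l<k t<r) k⊓r≤J)
    where
    below : ∀ J → suc (l ℕ.⊓ t) ℕ.≤ J → altSum (layer N l t) J ≡ value l N t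
    below (suc J) (ℕ.s≤s l⊓t≤J) = altSum-layer N J l t l⊓t≤J

signℚ-suc : ∀ j → signℚ (suc j) ≡ - signℚ j
signℚ-suc zero = refl
signℚ-suc (suc zero) = refl
signℚ-suc (suc (suc j)) = signℚ-suc j

signed-sum : ∀ (f : ℕ → ℚ) J → sumℚ (map (λ i → signℚ (suc i) * f i) (upTo J)) ≡ altSum f J
signed-sum f J = trans (cong sumℚ (Listₚ.map-applyUpTo id (λ i → signℚ (suc i) * f i) J)) (go f J)
  where
  negate : ∀ (g h : ℕ → ℚ) J → (∀ i → g i ≡ - h i) → sumℚ (applyUpTo g J) ≡ - sumℚ (applyUpTo h J)
  negate g h zero _ = refl
  negate g h (suc J) e = trans (cong₂ _+_ (e 0) (negate (λ i → g (suc i)) (λ i → h (suc i)) J (λ i → e (suc i))))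
    (sym (neg-distrib-+ (h 0) _))
  go : ∀ f J → sumℚ (applyUpTo (λ i → signℚ (suc i) * f i) J) ≡ altSum f J
  go f zero = refl
  go f (suc J) = cong₂ _+_ (*-identityˡ (f 0)) (trans
    (negate (λ i → signℚ (suc (suc i)) * f (suc i)) (λ i → signℚ (suc i) * f (suc i)) J
      (λ i → trans (cong (_* f (suc i)) (signℚ-suc (suc i))) (sym (neg-distribˡ-* (signℚ (suc i)) (f (suc i))))))
    (cong -_ (go (λ i → f (suc i)) J)))

rhs≤-altSum : ∀ N r k → rhs≤ N r k ≡ altSum (λ j → layer N k r (suc j)) (r ℕ.⊓ k)
rhs≤-altSum N r k = trans
  (sumℚ-ext (upTo (r ℕ.⊓ k)) (λ i → cong (_*_ (signℚ (suc i))) (trans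
    (sumℚ-concat (λ a → map (λ b → ζ≤ N (zipWith ℕ._+_ a b)) (comps r (suc i))) (comps k (suc i)))
    (pairSum-reverse k r (suc i) (Zrev N)))))
  (signed-sum (λ j → layer N k r (suc j)) (r ℕ.⊓ k))

rhs≤-value : ∀ N r k → rhs≤ N r (suc k) ≡ - value (suc k) N r
rhs≤-value N r k = begin-equality
  rhs≤ N r (suc k)
    ≡⟨ rhs≤-altSum N r (suc k) ⟩
  A
    -- The 0 is the layer of depth 0: the positive integer k + 1 has no composition with no parts.
    ≡⟨ double-neg A ⟩
  - (0ℚ - A)
    ≡⟨ cong -_ (altSum-layer N (r ℕ.⊓ suc k) (suc k) r (ℕₚ.≤-reflexive (ℕₚ.⊓-comm (suc k) r))) ⟩
  - value (suc k) N r ∎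
  where
  A = altSum (λ j → layer N (suc k) r (suc j)) (r ℕ.⊓ suc k)
  double-neg : ∀ x → x ≡ - (0ℚ - x)
  double-neg = solve-∀ ring

-- Inequalities for powers and reciprocals.

≤-by : ∀ {p q} e → 0ℚ ≤ e → q ≡ p + e → p ≤ q
≤-by {p} {q} e 0≤e q≡ = begin
  p      ≡⟨ +-identityʳ p ⟨
  p + 0ℚ ≤⟨ +-monoʳ-≤ p 0≤e ⟩
  p + e  ≡⟨ q≡ ⟨
  q      ∎

0≤1 : 0ℚ ≤ 1ℚ
0≤1 = nonNegative⁻¹ 1ℚ

0≤powℚ : ∀ {q} → 0ℚ ≤ q → ∀ k → 0ℚ ≤ powℚ q k
0≤powℚ 0≤q zero = 0≤1
0≤powℚ 0≤q (suc k) = 0≤* 0≤q (0≤powℚ 0≤q k)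

powℚ-mono-≤ : ∀ {p q} → 0ℚ ≤ p → p ≤ q → ∀ k → powℚ p k ≤ powℚ q k
powℚ-mono-≤ 0≤p p≤q zero = ≤-refl
powℚ-mono-≤ 0≤p p≤q (suc k) = *-mono-≤ (≤-trans 0≤p p≤q) (0≤powℚ 0≤p k) p≤q (powℚ-mono-≤ 0≤p p≤q k)

0≤num : ∀ n → 0ℚ ≤ num n
0≤num zero = ≤-refl
0≤num (suc n) = 0≤+ 0≤1 (0≤num n)

num-mono-≤ : ∀ {m n} → m ℕ.≤ n → num m ≤ num n
num-mono-≤ {n = n} ℕ.z≤n = 0≤num n
num-mono-≤ (ℕ.s≤s m≤n) = +-monoʳ-≤ 1ℚ (num-mono-≤ m≤n)

inv-anti-≤ : ∀ n m → inv (suc (n ℕ.+ m)) ≤ inv (suc m)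
inv-anti-≤ n m = begin
  i                             ≡⟨ *-identityʳ i ⟨
  i * 1ℚ                        ≡⟨ cong (_*_ i) (num*inv m) ⟨
  i * (num (suc m) * inv (suc m)) ≤⟨ *-mono-≤ (0≤inv (suc (n ℕ.+ m))) (0≤* (0≤num (suc m)) (0≤inv (suc m))) ≤-refl
                                     (*-mono-≤ (0≤num (suc (n ℕ.+ m))) (0≤inv (suc m)) (num-mono-≤ (ℕ.s≤s (ℕₚ.m≤n+m m n))) ≤-refl) ⟩
  i * (num (suc (n ℕ.+ m)) * inv (suc m)) ≡⟨ inv-cancel (n ℕ.+ m) (inv (suc m)) ⟩
  inv (suc m)                   ∎
  where i = inv (suc (n ℕ.+ m))

inv≤1 : ∀ n → inv n ≤ 1ℚ
inv≤1 zero = 0≤1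
inv≤1 (suc n) = subst (λ k → inv (suc k) ≤ 1ℚ) (ℕₚ.+-identityʳ n) (inv-anti-≤ n 0)

powℚ-inv≤inv : ∀ n k → powℚ (inv n) (suc k) ≤ inv n
powℚ-inv≤inv n k = begin
  inv n * powℚ (inv n) k ≤⟨ *-mono-≤ (0≤inv n) (0≤powℚ (0≤inv n) k) ≤-refl (pow≤1 k) ⟩
  inv n * 1ℚ             ≡⟨ *-identityʳ (inv n) ⟩
  inv n                  ∎
  where
  pow≤1 : ∀ k → powℚ (inv n) k ≤ 1ℚ
  pow≤1 zero = ≤-refl
  pow≤1 (suc k) = ≤-trans (*-mono-≤ 0≤1 (0≤powℚ (0≤inv n) k) (inv≤1 n) (pow≤1 k)) (≤-reflexive (*-identityˡ 1ℚ))

-- Harmonic numbers and coefficient majorants.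

harmonic : ℕ → ℚ
harmonic zero = 0ℚ
harmonic (suc n) = inv (suc n) + harmonic n

0≤harmonic : ∀ n → 0ℚ ≤ harmonic n
0≤harmonic zero = ≤-refl
0≤harmonic (suc n) = 0≤+ (0≤inv (suc n)) (0≤harmonic n)

harmonic-step : ∀ n → harmonic n ≤ harmonic (suc n)
harmonic-step n = ≤-by (inv (suc n)) (0≤inv (suc n)) (+-comm (inv (suc n)) (harmonic n))

harmonic-mono-≤ : ∀ n m → harmonic m ≤ harmonic (n ℕ.+ m)
harmonic-mono-≤ zero m = ≤-refl
harmonic-mono-≤ (suc n) m = ≤-trans (harmonic-mono-≤ n m) (harmonic-step (n ℕ.+ m))

1≤harmonic : ∀ n → 1ℚ ≤ harmonic (suc n)
1≤harmonic zero = ≤-refl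
1≤harmonic (suc n) = ≤-trans (1≤harmonic n) (harmonic-step (suc n))

conv-inv : ∀ N → conv (λ n _ → inv n) (suc N) ≡ harmonic N
conv-inv zero = refl
conv-inv (suc N) = trans (conv-last (λ n _ → inv n) (suc N)) (cong (_+_ (inv (suc N))) (conv-inv N))

conv-inv-suc : ∀ N → conv (λ _ m → inv (suc m)) N ≡ harmonic N
conv-inv-suc zero = refl
conv-inv-suc (suc N) = cong (_+_ (inv (suc N))) (conv-inv-suc N)

-- Nonnegative coefficients majorised by those of c/(1 - L y).
Bounded : ℚ → ℚ → Series → Set
Bounded c L f = ∀ s → 0ℚ ≤ f s × f s ≤ c * powℚ L s

Bounded-mono : ∀ {c L L′ f} → 0ℚ ≤ c → 0ℚ ≤ L → L ≤ L′ → Bounded c L f → Bounded c L′ f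
Bounded-mono 0≤c 0≤L L≤L′ b s =
  proj₁ (b s) , ≤-trans (proj₂ (b s)) (*-mono-≤ 0≤c (0≤powℚ 0≤L s) ≤-refl (powℚ-mono-≤ 0≤L L≤L′ s))

-- The product of 1/(1 - q y) and 1/(1 - L y) is majorised by 1/(1 - (q+L) y). Thus a product of
-- geometric factors keeps the constant c and only adds up the radii.
geo-Bounded : ∀ {c L f} q → 0ℚ ≤ q → 0ℚ ≤ c → 0ℚ ≤ L → Bounded c L f → Bounded c (q + L) (geo q f)
geo-Bounded q 0≤q 0≤c 0≤L b zero = b zero
geo-Bounded {c} {L} {f} q 0≤q 0≤c 0≤L b (suc s) =
  0≤+ (proj₁ (b (suc s))) (0≤* 0≤q (proj₁ rec)) , (begin
    f (suc s) + q * geo q f s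
      ≤⟨ +-mono-≤ (proj₂ (b (suc s))) (*-mono-≤ 0≤q (proj₁ rec) ≤-refl (proj₂ rec)) ⟩
    c * (L * powℚ L s) + q * (c * powℚ (q + L) s)
      ≤⟨ +-monoˡ-≤ (q * (c * powℚ (q + L) s)) (*-mono-≤ 0≤c (0≤* 0≤L (0≤powℚ 0≤L s)) ≤-refl
           (*-mono-≤ 0≤L (0≤powℚ 0≤L s) ≤-refl (powℚ-mono-≤ 0≤L (≤-by q 0≤q (+-comm q L)) s))) ⟩
    c * (L * powℚ (q + L) s) + q * (c * powℚ (q + L) s)
      ≡⟨ collect c L q (powℚ (q + L) s) ⟩
    c * ((q + L) * powℚ (q + L) s) ∎)
  where
  rec = geo-Bounded q 0≤q 0≤c 0≤L b s
  collect : ∀ c L q p → c * (L * p) + q * (c * p) ≡ c * ((q + L) * p)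
  collect = solve-∀ ring

geos-Bounded : ∀ {c L f} n m → 0ℚ ≤ c → 0ℚ ≤ L → Bounded c L f → Bounded c (harmonic (n ℕ.+ m) + L) (geos n m f)
geos-Bounded {L = L} zero m 0≤c 0≤L b = Bounded-mono 0≤c 0≤L (≤-by (harmonic m) (0≤harmonic m) (+-comm (harmonic m) L)) b
geos-Bounded {c} {L} {f} (suc n) m 0≤c 0≤L b =
  subst (λ x → Bounded c x (geos (suc n) m f)) (sym (+-assoc (inv (suc (n ℕ.+ m))) (harmonic (n ℕ.+ m)) L))
    (geo-Bounded (inv (suc (n ℕ.+ m))) (0≤inv (suc (n ℕ.+ m))) 0≤c (0≤+ (0≤harmonic (n ℕ.+ m)) 0≤L)
      (geos-Bounded n m 0≤c 0≤L b))

geos-increasing : ∀ {c L f} n m → 0ℚ ≤ c → 0ℚ ≤ L → Bounded c L f → ∀ t →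
  0ℚ ≤ geos n m f (suc t) - f (suc t)
geos-increasing {f = f} zero m 0≤c 0≤L b t = ≤-reflexive (sym (+-inverseʳ (f (suc t))))
geos-increasing {f = f} (suc n) m 0≤c 0≤L b t = begin
  0ℚ ≤⟨ 0≤+ (geos-increasing n m 0≤c 0≤L b t) (0≤* (0≤inv (suc (n ℕ.+ m))) (proj₁ (geos-Bounded (suc n) m 0≤c 0≤L b t))) ⟩
  geos n m f (suc t) - f (suc t) + q * geos (suc n) m f t
    ≡⟨ swap (geos n m f (suc t)) (f (suc t)) (q * geos (suc n) m f t) ⟩
  geos n m f (suc t) + q * geos (suc n) m f t - f (suc t) ∎
  where
  q = inv (suc (n ℕ.+ m))
  swap : ∀ x y z → x - y + z ≡ x + z - y
  swap = solve-∀ ring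

-- Each of the n factors 1/(1 - q y) has q ≤ 1/(m+1) and raises the coefficient of y^{t+1} by q
-- times a coefficient of y^t, which `geos-Bounded` controls.
geos-growth : ∀ {c L f} n m → 0ℚ ≤ c → 0ℚ ≤ L → Bounded c L f → ∀ t →
  geos n m f (suc t) - f (suc t) ≤ num n * (inv (suc m) * (c * powℚ (harmonic (n ℕ.+ m) + L) t))
geos-growth {c} {L} {f} zero m 0≤c 0≤L b t =
  ≤-reflexive (trans (+-inverseʳ (f (suc t))) (sym (*-zeroˡ (inv (suc m) * (c * powℚ (harmonic m + L) t)))))
geos-growth {c} {L} {f} (suc n) m 0≤c 0≤L b t = begin
  g + q * g′ - f (suc t)
    ≡⟨ swap g (f (suc t)) (q * g′) ⟩
  g - f (suc t) + q * g′
    ≤⟨ +-mono-≤ (geos-growth n m 0≤c 0≤L b t) (*-mono-≤ (0≤inv (suc m)) (proj₁ bound) (inv-anti-≤ n m) (proj₂ bound)) ⟩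
  num n * (inv (suc m) * (c * powℚ (harmonic (n ℕ.+ m) + L) t)) + inv (suc m) * (c * powℚ H t)
    ≤⟨ +-monoˡ-≤ (inv (suc m) * (c * powℚ H t)) (*-mono-≤ (0≤num n) (0≤* (0≤inv (suc m)) (0≤* 0≤c (0≤powℚ 0≤H t))) ≤-refl
         (*-mono-≤ (0≤inv (suc m)) (0≤* 0≤c (0≤powℚ 0≤H t)) ≤-refl
           (*-mono-≤ 0≤c (0≤powℚ 0≤H t) ≤-refl
             (powℚ-mono-≤ 0≤H (+-monoˡ-≤ L (harmonic-step (n ℕ.+ m))) t)))) ⟩
  num n * (inv (suc m) * (c * powℚ H t)) + inv (suc m) * (c * powℚ H t)
    ≡⟨ collect (num n) (inv (suc m) * (c * powℚ H t)) ⟩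
  num (suc n) * (inv (suc m) * (c * powℚ H t)) ∎
  where
  q = inv (suc (n ℕ.+ m))
  g = geos n m f (suc t)
  g′ = geos (suc n) m f t
  H = harmonic (suc n ℕ.+ m) + L
  0≤H : 0ℚ ≤ harmonic (n ℕ.+ m) + L
  0≤H = 0≤+ (0≤harmonic (n ℕ.+ m)) 0≤L
  bound = geos-Bounded (suc n) m 0≤c 0≤L b t
  swap : ∀ x y z → x + z - y ≡ x - y + z
  swap = solve-∀ ring
  collect : ∀ a x → a * x + x ≡ (1ℚ + a) * x
  collect = solve-∀ ring

-- Rising factorials as multiple harmonic sums with all exponents 1.

Zones : ℕ → Series
Zones n s = Zrev n (replicate s 1)

Zones-suc : ∀ n s → Zones (suc n) s ≡ mulLin 1ℚ (inv (suc n)) (Zones n) s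
Zones-suc n zero = unit (inv (suc n))
  where
  unit : ∀ q → 1ℚ ≡ 1ℚ * 1ℚ + q * 0ℚ
  unit = solve-∀ ring
Zones-suc n (suc s) = unit (Zones n (suc s)) (inv (suc n)) (Zones n s)
  where
  unit : ∀ x q y → x + q * 1ℚ * y ≡ 1ℚ * x + q * y
  unit = solve-∀ ring

Zones-Bounded : ∀ n → Bounded 1ℚ (harmonic n) (Zones n)
Zones-Bounded zero zero = 0≤1 , ≤-refl
Zones-Bounded zero (suc s) = ≤-refl , 0≤* 0≤1 (0≤powℚ {0ℚ} ≤-refl (suc s))
Zones-Bounded (suc n) zero = 0≤1 , ≤-refl
Zones-Bounded (suc n) (suc s) =
  subst (0ℚ ≤_) (sym eq) (0≤+ (proj₁ (b (suc s))) (0≤* 0≤q (proj₁ (b s)))) , (begin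
    Zones (suc n) (suc s)
      ≡⟨ eq ⟩
    Zones n (suc s) + q * Zones n s
      ≤⟨ +-mono-≤ (proj₂ (b (suc s))) (*-mono-≤ 0≤q (proj₁ (b s)) ≤-refl (proj₂ (b s))) ⟩
    1ℚ * (h * powℚ h s) + q * (1ℚ * powℚ h s)
      ≡⟨ collect q h (powℚ h s) ⟩
    1ℚ * ((q + h) * powℚ h s)
      ≤⟨ *-mono-≤ 0≤1 (0≤* (0≤harmonic (suc n)) (0≤powℚ (0≤harmonic n) s)) ≤-refl
           (*-mono-≤ (0≤harmonic (suc n)) (0≤powℚ (0≤harmonic n) s) ≤-refl (powℚ-mono-≤ (0≤harmonic n) (harmonic-step n) s)) ⟩
    1ℚ * powℚ (harmonic (suc n)) (suc s) ∎)
  where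
  q = inv (suc n)
  h = harmonic n
  b = Zones-Bounded n
  0≤q = 0≤inv (suc n)
  unit : ∀ x q y → x + q * 1ℚ * y ≡ x + q * y
  unit = solve-∀ ring
  eq : Zones (suc n) (suc s) ≡ Zones n (suc s) + q * Zones n s
  eq = unit (Zones n (suc s)) q (Zones n s)
  collect : ∀ q h p → 1ℚ * (h * p) + q * (1ℚ * p) ≡ 1ℚ * ((q + h) * p)
  collect = solve-∀ ring

rising-suc-zero : ∀ n → rising (suc n) 0 ≡ 0ℚ
rising-suc-zero zero = refl
rising-suc-zero (suc n) = trans (cong (λ x → inv (suc (suc n)) * num (suc n) * x + inv (suc (suc n)) * 0ℚ) (rising-suc-zero n))
  (zeros (inv (suc (suc n)) * num (suc n)) (inv (suc (suc n))))
  where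
  zeros : ∀ a b → a * 0ℚ + b * 0ℚ ≡ 0ℚ
  zeros = solve-∀ ring

-- Comes from (y)_{n+1}/(n+1)! = y/(n+1) · Π_{i≤n} (1 + y/i), where the last product has the
-- coefficients `Zones n`.
rising-suc : ∀ n s → rising (suc n) (suc s) ≡ inv (suc n) * Zones n s
rising-suc zero s = trans (unit (inv 1) (rising 0 (suc s)) (rising 0 s)) (cong (_*_ (inv 1)) (base s))
  where
  unit : ∀ i x y → i * 0ℚ * x + i * y ≡ i * y
  unit = solve-∀ ring
  base : ∀ s → rising 0 s ≡ Zones 0 s
  base zero = refl
  base (suc s) = refl
rising-suc (suc n) s = begin-equality
  i * num (suc n) * rising (suc n) (suc s) + i * rising (suc n) s
    ≡⟨ cong (λ x → i * num (suc n) * x + i * rising (suc n) s) (rising-suc n s) ⟩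
  i * num (suc n) * (inv (suc n) * Zones n s) + i * rising (suc n) s
    ≡⟨ regroup i (num (suc n)) (inv (suc n)) (Zones n s) (rising (suc n) s) ⟩
  i * (num (suc n) * inv (suc n) * Zones n s + rising (suc n) s)
    ≡⟨ cong₂ (λ x y → i * (x * Zones n s + y)) (num*inv n) (shifted s) ⟩
  i * mulLin 1ℚ (inv (suc n)) (Zones n) s
    ≡⟨ cong (_*_ i) (Zones-suc n s) ⟨
  i * Zones (suc n) s ∎
  where
  i = inv (suc (suc n))
  regroup : ∀ i a j z y → i * a * (j * z) + i * y ≡ i * (a * j * z + y)
  regroup = solve-∀ ring
  shifted : ∀ s → rising (suc n) s ≡ inv (suc n) * shift (Zones n) s
  shifted zero = trans (rising-suc-zero n) (sym (*-zeroʳ (inv (suc n))))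
  shifted (suc s) = rising-suc n s

-- The factor y shifts the degree by one, so the bound H_n^s has to serve in degree s + 1; the
-- hypothesis 1 ≤ L pays for the extra power.
rising-Bounded : ∀ n {L} → 1ℚ ≤ L → harmonic n ≤ L → Bounded (inv (suc n)) L (rising (suc n))
rising-Bounded n {L} 1≤L h≤L zero =
  ≤-reflexive (sym (rising-suc-zero n)) , ≤-trans (≤-reflexive (rising-suc-zero n)) (0≤* (0≤inv (suc n)) 0≤1)
rising-Bounded n {L} 1≤L h≤L (suc s) =
  subst (0ℚ ≤_) (sym (rising-suc n s)) (0≤* (0≤inv (suc n)) (proj₁ b)) , (begin
    rising (suc n) (suc s)
      ≡⟨ rising-suc n s ⟩
    inv (suc n) * Zones n s
      ≤⟨ *-mono-≤ (0≤inv (suc n)) (proj₁ b) ≤-refl (≤-trans (proj₂ b)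
           (*-mono-≤ (≤-trans 0≤1 1≤L) (0≤powℚ (0≤harmonic n) s) 1≤L (powℚ-mono-≤ (0≤harmonic n) h≤L s))) ⟩
    inv (suc n) * powℚ L (suc s) ∎)
  where
  b = Zones-Bounded n s

reverse-replicate : ∀ {A : Set} n (x : A) → reverse (replicate n x) ≡ replicate n x
reverse-replicate zero x = refl
reverse-replicate (suc n) x = trans (Listₚ.unfold-reverse x (replicate n x))
  (trans (cong (_++ [ x ]) (reverse-replicate n x)) (snoc n))
  where
  snoc : ∀ n → replicate n x ++ [ x ] ≡ x ∷ replicate n x
  snoc zero = refl
  snoc (suc n) = cong (x ∷_) (snoc n)

lhs-conv : ∀ k t N → ζ≤ N (lhsIndex (suc t) (suc k)) ≡ conv (λ n _ → - coef (suc k) n * rising n (suc t)) (suc N)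
lhs-conv k t N = trans (cong (Zrev N) (trans (Listₚ.reverse-++ (replicate t 1) [ suc (suc k) ])
  (cong (suc (suc k) ∷_) (reverse-replicate t 1)))) (go N)
  where
  g : ℕ → ℚ
  g n = - coef (suc k) n * rising n (suc t)
  regroup : ∀ q p z → q * p * z ≡ - - p * (q * z)
  regroup = solve-∀ ring
  go : ∀ N → Zrev N (suc (suc k) ∷ replicate t 1) ≡ conv (λ n _ → g n) (suc N)
  go zero = refl
  go (suc N) = begin-equality
    Zrev N (suc (suc k) ∷ replicate t 1) + q * powℚ q (suc k) * Zones N t
      ≡⟨ cong₂ _+_ (go N) (regroup q (powℚ q (suc k)) (Zones N t)) ⟩
    conv (λ n _ → g n) (suc N) + - coef (suc k) (suc N) * (q * Zones N t)
      ≡⟨ cong (λ x → conv (λ n _ → g n) (suc N) + - coef (suc k) (suc N) * x) (rising-suc N t) ⟨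
    conv (λ n _ → g n) (suc N) + g (suc N)
      ≡⟨ +-comm (conv (λ n _ → g n) (suc N)) (g (suc N)) ⟩
    g (suc N) + conv (λ n _ → g n) (suc N)
      ≡⟨ conv-last (λ n _ → g n) (suc N) ⟨
    conv (λ n _ → g n) (suc (suc N)) ∎
    where q = inv (suc N)

-- The difference of the two truncations and its bound.

gap : ℕ → ℕ → ℕ → ℚ
gap k t N = conv (λ n m → - coef (suc k) n * (term n m (suc t) - rising n (suc t))) (suc N)

lhs-rhs : ∀ k t N → ζ≤ N (lhsIndex (suc t) (suc k)) - rhs≤ N (suc t) (suc k) ≡ - gap k t N
lhs-rhs k t N = begin-equality
  ζ≤ N (lhsIndex (suc t) (suc k)) - rhs≤ N (suc t) (suc k)
    ≡⟨ cong₂ _-_ (lhs-conv k t N) (rhs≤-value N (suc t) k) ⟩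
  X - - value (suc k) N (suc t)
    ≡⟨ regroup X (value (suc k) N (suc t)) ⟩
  - (- 1ℚ * value (suc k) N (suc t) + - 1ℚ * X)
    ≡⟨ cong -_ (cong₂ _+_ (sym (conv-* (- 1ℚ) (λ n m → coef (suc k) n * term n m (suc t)) (suc N)))
         (sym (conv-* (- 1ℚ) (λ n _ → - coef (suc k) n * rising n (suc t)) (suc N)))) ⟩
  - (conv (λ n m → - 1ℚ * (coef (suc k) n * term n m (suc t))) (suc N)
    + conv (λ n _ → - 1ℚ * (- coef (suc k) n * rising n (suc t))) (suc N))
    ≡⟨ cong -_ (sym (conv-+ (λ n m → - 1ℚ * (coef (suc k) n * term n m (suc t)))
         (λ n _ → - 1ℚ * (- coef (suc k) n * rising n (suc t))) (suc N))) ⟩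
  - conv (λ n m → - 1ℚ * (coef (suc k) n * term n m (suc t)) + - 1ℚ * (- coef (suc k) n * rising n (suc t))) (suc N)
    ≡⟨ cong -_ (conv-ext (suc N) (λ n m → collect (coef (suc k) n) (term n m (suc t)) (rising n (suc t)))) ⟩
  - gap k t N ∎
  where
  X = conv (λ n _ → - coef (suc k) n * rising n (suc t)) (suc N)
  regroup : ∀ x y → x - - y ≡ - (- 1ℚ * y + - 1ℚ * x)
  regroup = solve-∀ ring
  collect : ∀ c x y → - 1ℚ * (c * x) + - 1ℚ * (- c * y) ≡ - c * (x - y)
  collect = solve-∀ ring

inv*inv : ∀ n m → inv (suc n) * inv (suc m) ≡ inv (suc (suc n ℕ.+ m)) * (inv (suc n) + inv (suc m))
inv*inv n m = begin-equality
  i * j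
    ≡⟨ sym (inv-cancel (suc n ℕ.+ m) (i * j)) ⟩
  q * (num (suc (suc n ℕ.+ m)) * (i * j))
    ≡⟨ cong (λ x → q * ((1ℚ + x) * (i * j))) (num-+ (suc n) m) ⟩
  q * ((1ℚ + (num (suc n) + num m)) * (i * j))
    ≡⟨ regroup q (num (suc n)) (num m) i j ⟩
  q * (num (suc m) * j * i + num (suc n) * i * j)
    ≡⟨ cong₂ (λ x y → q * (x * i + y * j)) (num*inv m) (num*inv n) ⟩
  q * (1ℚ * i + 1ℚ * j)
    ≡⟨ unit q i j ⟩
  q * (i + j) ∎
  where
  i = inv (suc n)
  j = inv (suc m)
  q = inv (suc (suc n ℕ.+ m))
  regroup : ∀ q a b i j → q * ((1ℚ + (a + b)) * (i * j)) ≡ q * ((1ℚ + b) * j * i + a * i * j)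
  regroup = solve-∀ ring
  unit : ∀ q i j → q * (1ℚ * i + 1ℚ * j) ≡ q * (i + j)
  unit = solve-∀ ring

-- One harmonic number comes from the geometric factors, the other from the majorant of `rising`.
radius : ℕ → ℚ
radius N = harmonic N + harmonic N

0≤radius : ∀ N → 0ℚ ≤ radius N
0≤radius N = 0≤+ (0≤harmonic N) (0≤harmonic N)

-- The growth factor n/(m+1) of geos-growth times n^{-2} is 1/(n(m+1)) = (1/n + 1/(m+1)) / (n+m+1).
gap-term : ∀ k t N n m → suc (n ℕ.+ m) ≡ suc N →
  0ℚ ≤ - coef (suc k) n * (term n m (suc t) - rising n (suc t)) ×
  - coef (suc k) n * (term n m (suc t) - rising n (suc t))
    ≤ inv (suc N) * powℚ (radius (suc N)) t * (inv n + inv (suc m))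
gap-term k t N zero m eq = ≤-reflexive (sym vanishes) , (begin
  - 0ℚ * (term 0 m (suc t) - rising 0 (suc t))
    ≡⟨ vanishes ⟩
  0ℚ
    ≤⟨ 0≤* (0≤* (0≤inv (suc N)) (0≤powℚ (0≤radius (suc N)) t)) (0≤+ {0ℚ} ≤-refl (0≤inv (suc m))) ⟩
  inv (suc N) * powℚ (radius (suc N)) t * (inv 0 + inv (suc m)) ∎)
  where
  vanishes : - 0ℚ * (term 0 m (suc t) - rising 0 (suc t)) ≡ 0ℚ
  vanishes = *-zeroˡ (term 0 m (suc t) - rising 0 (suc t))
gap-term k t .(suc n ℕ.+ m) (suc n) m refl =
  0≤* 0≤w (geos-increasing (suc n) m 0≤i 0≤h bounded t) , (begin
    - - powℚ i (suc k) * (term (suc n) m (suc t) - rising (suc n) (suc t))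
      -- Of the k + 1 factors 1/n in the weight only one is kept; the second 1/n comes from the
      -- bound on `rising`.
      ≤⟨ *-mono-≤ 0≤i (geos-increasing (suc n) m 0≤i 0≤h bounded t)
           (≤-trans (≤-reflexive (neg-neg (powℚ i (suc k)))) (powℚ-inv≤inv (suc n) k))
           (geos-growth (suc n) m 0≤i 0≤h bounded t) ⟩
    i * (num (suc n) * (j * (i * powℚ (harmonic N + h) t)))
      ≡⟨ inv-cancel n (j * (i * powℚ (harmonic N + h) t)) ⟩
    j * (i * powℚ (harmonic N + h) t)
      ≤⟨ *-mono-≤ (0≤inv (suc m)) (0≤* 0≤i (0≤powℚ 0≤N+h t)) ≤-refl
           (*-mono-≤ 0≤i (0≤powℚ 0≤N+h t) ≤-refl (powℚ-mono-≤ 0≤N+h (+-monoˡ-≤ h (harmonic-step N)) t)) ⟩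
    j * (i * powℚ (radius (suc N)) t)
      ≡⟨ regroup i j (powℚ (radius (suc N)) t) ⟩
    i * j * powℚ (radius (suc N)) t
      ≡⟨ cong (_* powℚ (radius (suc N)) t) (inv*inv n m) ⟩
    inv (suc N) * (i + j) * powℚ (radius (suc N)) t
      ≡⟨ swap (inv (suc N)) (i + j) (powℚ (radius (suc N)) t) ⟩
    inv (suc N) * powℚ (radius (suc N)) t * (i + j) ∎)
  where
  N = suc n ℕ.+ m
  i = inv (suc n)
  j = inv (suc m)
  h = harmonic (suc N)
  0≤i = 0≤inv (suc n)
  0≤h = 0≤harmonic (suc N)
  0≤N+h = 0≤+ (0≤harmonic N) 0≤h
  harmonic-n≤h : harmonic n ≤ h
  harmonic-n≤h = subst (λ x → harmonic n ≤ harmonic x) (cong (λ x → suc (suc x)) (ℕₚ.+-comm m n)) (harmonic-mono-≤ (suc (suc m)) n)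
  bounded : Bounded i h (rising (suc n))
  bounded = rising-Bounded n (1≤harmonic N) harmonic-n≤h
  neg-neg : ∀ x → - - x ≡ x
  neg-neg = solve-∀ ring
  0≤w : 0ℚ ≤ - - powℚ i (suc k)
  0≤w = ≤-trans (0≤powℚ 0≤i (suc k)) (≤-reflexive (sym (neg-neg (powℚ i (suc k)))))
  regroup : ∀ i j p → j * (i * p) ≡ i * j * p
  regroup = solve-∀ ring
  swap : ∀ q x p → q * x * p ≡ q * p * x
  swap = solve-∀ ring

0≤gap : ∀ k t N → 0ℚ ≤ gap k t N
0≤gap k t N = ≤-trans (≤-reflexive (sym (conv-0 (suc N)))) (conv-mono-≤ (suc N) (λ n m e → proj₁ (gap-term k t N n m e)))

-- Summing 1/n and 1/(m+1) over n + m = N gives H_N + H_{N+1}, which costs one more factor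
-- `radius (suc N)`.
gap≤ : ∀ k t N → gap k t N ≤ inv (suc N) * powℚ (radius (suc N)) (suc t)
gap≤ k t N = begin
  gap k t N
    ≤⟨ conv-mono-≤ (suc N) (λ n m e → proj₂ (gap-term k t N n m e)) ⟩
  conv (λ n m → c * (inv n + inv (suc m))) (suc N)
    ≡⟨ conv-* c (λ n m → inv n + inv (suc m)) (suc N) ⟩
  c * conv (λ n m → inv n + inv (suc m)) (suc N)
    ≡⟨ cong (_*_ c) (trans (conv-+ (λ n _ → inv n) (λ _ m → inv (suc m)) (suc N))
         (cong₂ _+_ (conv-inv N) (conv-inv-suc (suc N)))) ⟩
  c * (harmonic N + harmonic (suc N))
    ≤⟨ *-mono-≤ 0≤c (0≤+ (0≤harmonic N) (0≤harmonic (suc N))) ≤-refl (+-monoˡ-≤ (harmonic (suc N)) (harmonic-step N)) ⟩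
  c * radius (suc N)
    ≡⟨ regroup (inv (suc N)) (powℚ (radius (suc N)) t) (radius (suc N)) ⟩
  inv (suc N) * powℚ (radius (suc N)) (suc t) ∎
  where
  c = inv (suc N) * powℚ (radius (suc N)) t
  0≤c = 0≤* (0≤inv (suc N)) (0≤powℚ (0≤radius (suc N)) t)
  regroup : ∀ q p x → q * p * x ≡ q * (x * p)
  regroup = solve-∀ ring

-- Powers of harmonic numbers grow more slowly than any linear function.

powℚ-increment : ∀ {h d} → 0ℚ ≤ h → 0ℚ ≤ d → ∀ p →
  powℚ (h + d) (suc p) ≤ powℚ h (suc p) + num (suc p) * (d * powℚ (h + d) p)
powℚ-increment {h} {d} 0≤h 0≤d zero = ≤-reflexive (base h d)
  where
  base : ∀ h d → (h + d) * 1ℚ ≡ h * 1ℚ + (1ℚ + 0ℚ) * (d * 1ℚ)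
  base = solve-∀ ring
powℚ-increment {h} {d} 0≤h 0≤d (suc p) = begin
  (h + d) * P
    ≡⟨ *-distribʳ-+ P h d ⟩
  h * P + d * P
    ≤⟨ +-monoˡ-≤ (d * P) (*-mono-≤ 0≤h (0≤powℚ 0≤h+d (suc p)) ≤-refl (powℚ-increment 0≤h 0≤d p)) ⟩
  h * (powℚ h (suc p) + num (suc p) * (d * Q)) + d * P
    -- Replacing the factor h by h + d in the second summand leaves the slack (p+1) d² (h+d)^p.
    ≤⟨ ≤-by (num (suc p) * (d * (d * Q))) (0≤* (0≤num (suc p)) (0≤* 0≤d (0≤* 0≤d (0≤powℚ 0≤h+d p))))
         (regroup h d (powℚ h (suc p)) (num (suc p)) Q) ⟩
  powℚ h (suc (suc p)) + num (suc (suc p)) * (d * P) ∎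
  where
  P = powℚ (h + d) (suc p)
  Q = powℚ (h + d) p
  0≤h+d = 0≤+ 0≤h 0≤d
  regroup : ∀ h d x a q → h * x + (1ℚ + a) * (d * ((h + d) * q))
    ≡ h * (x + a * (d * q)) + d * ((h + d) * q) + a * (d * (d * q))
  regroup = solve-∀ ring

archimedean : ∀ x → ∃[ n ] x ≤ num n
archimedean x@(mkℚ p d _) = ℤ.∣ p ∣ , subst (x ≤_) (sym (num≡/1 ℤ.∣ p ∣))
  (toℚᵘ-cancel-≤ (ℚᵘₚ.≤-respʳ-≃ (ℚᵘₚ.≃-sym (toℚᵘ-fromℚᵘ (mkℚᵘ (+ ℤ.∣ p ∣) 0))) (ℚᵘ.*≤* (bound p))))
  where
  bound : ∀ p → p ℤ.* + 1 ℤ.≤ + ℤ.∣ p ∣ ℤ.* + suc d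
  bound (+ n) = subst₂ ℤ._≤_ (ℤₚ.pos-* n 1) (ℤₚ.pos-* n (suc d)) (ℤ.+≤+ (ℕₚ.*-monoʳ-≤ n (ℕ.s≤s ℕ.z≤n)))
  bound -[1+ n ] = ℤ.-≤+

eventually-small : ∀ C ε → 0ℚ < ε → ∃[ M ] (∀ N → M ℕ.≤ N → inv (suc N) * C ≤ ε)
eventually-small C ε 0<ε with archimedean (C * (1/ ε) {{>-nonZero 0<ε}})
... | M , bound = M , λ N M≤N → begin
  inv (suc N) * C
    ≡⟨ cong (_*_ (inv (suc N))) (begin-equality
         C                ≡⟨ *-identityʳ C ⟨
         C * 1ℚ           ≡⟨ cong (_*_ C) (*-inverseˡ ε {{>-nonZero 0<ε}}) ⟨
         C * (1/ε * ε)    ≡⟨ *-assoc C 1/ε ε ⟨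
         C * 1/ε * ε      ∎) ⟩
  inv (suc N) * (C * 1/ε * ε)
    ≤⟨ *-monoˡ-≤-nonNeg (inv (suc N)) {{nonNegative (0≤inv (suc N))}}
         (*-monoʳ-≤-nonNeg ε {{nonNegative (<⇒≤ 0<ε)}} (≤-trans bound (num-mono-≤ (ℕₚ.m≤n⇒m≤1+n M≤N)))) ⟩
  inv (suc N) * (num (suc N) * ε)
    ≡⟨ inv-cancel N ε ⟩
  ε ∎
  where 1/ε = (1/ ε) {{>-nonZero 0<ε}}

-- Increments of at most ε from M on give slope ε; the finitely many earlier values are absorbed
-- into C, one maximum for each unit of M.
linear-bound : ∀ {ε} → 0ℚ ≤ ε → ∀ M (f : ℕ → ℚ) → (∀ N → M ℕ.≤ N → f (suc N) ≤ f N + ε) →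
  ∃[ C ] (∀ N → f N ≤ ε * num N + C)
linear-bound {ε} 0≤ε zero f step = f 0 , go
  where
  base : ∀ ε x → x ≡ ε * 0ℚ + x
  base = solve-∀ ring
  regroup : ∀ ε a x → ε * a + x + ε ≡ ε * (1ℚ + a) + x
  regroup = solve-∀ ring
  go : ∀ N → f N ≤ ε * num N + f 0
  go zero = ≤-reflexive (base ε (f 0))
  go (suc N) = ≤-trans (step N ℕ.z≤n) (≤-trans (+-monoˡ-≤ ε (go N)) (≤-reflexive (regroup ε (num N) (f 0))))
linear-bound {ε} 0≤ε (suc M) f step with linear-bound 0≤ε M (λ N → f (suc N)) (λ N M≤N → step (suc N) (ℕ.s≤s M≤N))
... | C , bound = f 0 ⊔ C , go
  where
  go : ∀ N → f N ≤ ε * num N + (f 0 ⊔ C)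
  go zero = begin
    f 0           ≤⟨ p≤p⊔q (f 0) C ⟩
    f 0 ⊔ C       ≡⟨ base ε (f 0 ⊔ C) ⟩
    ε * 0ℚ + (f 0 ⊔ C) ∎
    where
    base : ∀ ε x → x ≡ ε * 0ℚ + x
    base = solve-∀ ring
  go (suc N) = begin
    f (suc N)
      ≤⟨ bound N ⟩
    ε * num N + C
      ≤⟨ +-mono-≤ (*-mono-≤ 0≤ε (0≤num N) ≤-refl (num-mono-≤ (ℕₚ.n≤1+n N))) (p≤q⊔p (f 0) C) ⟩
    ε * num (suc N) + (f 0 ⊔ C) ∎

0<½* : ∀ {x} → 0ℚ < x → 0ℚ < ½ * x
0<½* {x} 0<x = positive⁻¹ (½ * x) {{pos*pos⇒pos ½ x {{positive 0<x}}}}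

½*+½* : ∀ x → ½ * x + ½ * x ≡ x
½*+½* x = trans (sym (*-distribʳ-+ x ½ ½)) (*-identityˡ x)

-- δ = ε/(4(p+1)): one factor 2 because the radius grows by 2/(N+1), another because the increment
-- is split into two parts of size δ.
quarter-fraction : ∀ p ε → 0ℚ < ε → ∃[ δ ] 0ℚ < δ × (num (suc p) + num (suc p)) * (δ + δ) ≡ ε
quarter-fraction p ε 0<ε = i * (½ * (½ * ε)) , positive⁻¹ (i * η) {{pos*pos⇒pos i {{normalize-pos 1 (suc p)}} η {{positive 0<η}}}} , eq
  where
  i = inv (suc p)
  a = num (suc p)
  η = ½ * (½ * ε)
  0<η : 0ℚ < η
  0<η = 0<½* (0<½* 0<ε)
  collect : ∀ a i x → (a + a) * (i * x + i * x) ≡ a * i * ((x + x) + (x + x))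
  collect = solve-∀ ring
  eq : (a + a) * (i * η + i * η) ≡ ε
  eq = begin-equality
    (a + a) * (i * η + i * η)     ≡⟨ collect a i η ⟩
    a * i * ((η + η) + (η + η))   ≡⟨ cong₂ (λ x y → x * (y + y)) (num*inv p) (½*+½* (½ * ε)) ⟩
    1ℚ * (½ * ε + ½ * ε)          ≡⟨ trans (*-identityˡ (½ * ε + ½ * ε)) (½*+½* ε) ⟩
    ε                             ∎

powℚ-increment-bound : ∀ {h q δ k C} p → 0ℚ ≤ h → 0ℚ ≤ q →
  q * (k * δ) ≤ δ → q * C ≤ δ → powℚ (h + (q + q)) p ≤ δ * k + C →
  powℚ (h + (q + q)) (suc p) ≤ powℚ h (suc p) + (num (suc p) + num (suc p)) * (δ + δ)
powℚ-increment-bound {h} {q} {δ} {k} {C} p 0≤h 0≤q qkδ≤δ qC≤δ bound = begin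
  powℚ (h + (q + q)) (suc p)
    ≤⟨ powℚ-increment 0≤h (0≤+ 0≤q 0≤q) p ⟩
  powℚ h (suc p) + a * ((q + q) * powℚ (h + (q + q)) p)
    ≤⟨ +-monoʳ-≤ (powℚ h (suc p)) (*-monoˡ-≤-nonNeg a {{nonNegative 0≤a}}
         (*-monoˡ-≤-nonNeg (q + q) {{nonNegative (0≤+ 0≤q 0≤q)}} bound)) ⟩
  powℚ h (suc p) + a * ((q + q) * (δ * k + C))
    ≡⟨ cong (_+_ (powℚ h (suc p))) (regroup a q δ k C) ⟩
  powℚ h (suc p) + (a + a) * (q * (k * δ) + q * C)
    ≤⟨ +-monoʳ-≤ (powℚ h (suc p)) (*-monoˡ-≤-nonNeg (a + a) {{nonNegative (0≤+ 0≤a 0≤a)}} (+-mono-≤ qkδ≤δ qC≤δ)) ⟩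
  powℚ h (suc p) + (a + a) * (δ + δ) ∎
  where
  a = num (suc p)
  0≤a = 0≤num (suc p)
  regroup : ∀ a q d k c → a * ((q + q) * (d * k + c)) ≡ (a + a) * (q * (k * d) + q * c)
  regroup = solve-∀ ring

radius-suc : ∀ N → radius (suc N) ≡ radius N + (inv (suc N) + inv (suc N))
radius-suc N = double (inv (suc N)) (harmonic N)
  where
  double : ∀ q h → (q + h) + (q + h) ≡ (h + h) + (q + q)
  double = solve-∀ ring

radius-powℚ-step : ∀ {δ C} p N → inv (suc N) * C ≤ δ → powℚ (radius (suc N)) p ≤ δ * num (suc N) + C →
  powℚ (radius (suc N)) (suc p) ≤ powℚ (radius N) (suc p) + (num (suc p) + num (suc p)) * (δ + δ)
radius-powℚ-step {δ} {C} p N small bound =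
  subst (λ x → powℚ x (suc p) ≤ powℚ (radius N) (suc p) + (num (suc p) + num (suc p)) * (δ + δ)) (sym (radius-suc N))
    (powℚ-increment-bound p (0≤radius N) (0≤inv (suc N)) (≤-reflexive (inv-cancel N δ)) small
      (subst (λ x → powℚ x p ≤ δ * num (suc N) + C) (radius-suc N) bound))

Sublinear : (ℕ → ℚ) → Set
Sublinear f = ∀ ε → 0ℚ < ε → ∃[ C ] (∀ N → f N ≤ ε * num N + C)

-- Induction on the exponent: the (p+1)-st power grows at step N by at most (p+1) · 2/(N+1) times
-- the p-th power, which is at most δ(N+1) + C. Once C/(N+1) ≤ δ the increment is at most ε, and
-- `linear-bound` sums it up.
radius-powℚ-sublinear : ∀ p → Sublinear (λ N → powℚ (radius N) p)
radius-powℚ-sublinear zero ε 0<ε = 1ℚ , λ N →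
  ≤-by (ε * num N) (0≤* (<⇒≤ 0<ε) (0≤num N)) (+-comm (ε * num N) 1ℚ)
radius-powℚ-sublinear (suc p) ε 0<ε = linear-bound (<⇒≤ 0<ε) (proj₁ small) (λ N → powℚ (radius N) (suc p)) (λ N M≤N →
  ≤-trans (radius-powℚ-step p N (proj₂ small N M≤N) (proj₂ bound (suc N)))
          (+-monoʳ-≤ (powℚ (radius N) (suc p)) (≤-reflexive (proj₂ (proj₂ quarter)))))
  where
  quarter = quarter-fraction p ε 0<ε
  δ = proj₁ quarter
  0<δ = proj₁ (proj₂ quarter)
  bound = radius-powℚ-sublinear p δ 0<δ
  small = eventually-small (proj₁ bound) δ 0<δ

-- Convergence of the difference to zero.

gap-bound : ∀ {δ C} t k N → powℚ (radius (suc N)) (suc t) ≤ δ * num (suc N) + C → inv (suc N) * C ≤ δ →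
  gap k t N ≤ δ + δ
gap-bound {δ} {C} t k N bound small = begin
  gap k t N
    ≤⟨ gap≤ k t N ⟩
  inv (suc N) * powℚ (radius (suc N)) (suc t)
    ≤⟨ *-monoˡ-≤-nonNeg (inv (suc N)) {{nonNegative (0≤inv (suc N))}} bound ⟩
  inv (suc N) * (δ * num (suc N) + C)
    ≡⟨ regroup (inv (suc N)) δ (num (suc N)) C ⟩
  inv (suc N) * (num (suc N) * δ) + inv (suc N) * C
    ≤⟨ +-mono-≤ (≤-reflexive (inv-cancel N δ)) small ⟩
  δ + δ ∎
  where
  regroup : ∀ q d k c → q * (d * k + c) ≡ q * (k * d) + q * c
  regroup = solve-∀ ring

∣lhs-rhs∣ : ∀ k t N → ∣ ζ≤ N (lhsIndex (suc t) (suc k)) - rhs≤ N (suc t) (suc k) ∣ ≡ gap k t N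
∣lhs-rhs∣ k t N = trans (cong ∣_∣ (lhs-rhs k t N)) (trans (∣-p∣≡∣p∣ (gap k t N)) (0≤p⇒∣p∣≡p (0≤gap k t N)))

theorem1 : (r k : ℕ) → 1 ℕ.≤ r → 1 ℕ.≤ k →
    (ε : ℚ) → 0ℚ < ε →
    ∃[ M ] ((N : ℕ) → M ℕ.≤ N →
    ∣ ζ≤ N (lhsIndex r k) - rhs≤ N r k ∣ < ε)
theorem1 (suc t) (suc k) _ _ ε 0<ε = proj₁ small , λ N M≤N →
  ≤-<-trans (≤-reflexive (∣lhs-rhs∣ k t N))
  (≤-<-trans (gap-bound t k N (proj₂ bound (suc N)) (proj₂ small N M≤N))
  (≤-<-trans (≤-reflexive (½*+½* η)) η<ε))
  where
  -- The estimates give only a weak inequality, so they are run with some η strictly between 0 and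
  -- ε, half of it for each summand in `gap-bound`.
  η = proj₁ (<-dense 0<ε)
  0<η = proj₁ (proj₂ (<-dense 0<ε))
  η<ε = proj₂ (proj₂ (<-dense 0<ε))
  bound = radius-powℚ-sublinear (suc t) (½ * η) (0<½* 0<η)
  small = eventually-small (proj₁ bound) (½ * η) (0<½* 0<η)
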